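{- Let $k\ge1$, $\lambda\in\mathrm{Par}^k$, let $\kappa=\mathfrak p^{ -1}(\lambda)$, and let $\kappa/\eta$ be the $k$-skew diagram of $\lambda$. Regarding $\lambda$ as an element of $\mathbb Z^{\ell(\kappa)}$, we have $$H(\Delta^k(\lambda);\lambda)=H(\Phi(\kappa/\eta);\lambda).$$
   Context: For $\gamma\in\mathbb Z^\ell$, $s_\gamma=\det(h_{\gamma_i+j-i})_{1\le i,j\le\ell}$ ($h_0=1$, $h_d=0$ for $d<0$). $\Delta^+_\ell=\{(i,j):1\le i<j\le\ell\}$. For $\Psi\subset\Delta^+_\ell$ and $\gamma\in\mathbb Z^\ell$, the Catalan function $H(\Psi;\gamma)=\prod_{(i,j)\in\Psi}(1-tR_{ij})^{ -1}s_\gamma$ is obtained by expanding $\prod_{(i,j)\in\Psi}(1-tz_i/z_j)^{ -1}z^\gamma$ as a power series in $t$ and applying coefficientwise the linear map $z^\beta\mapsto s_\beta$. $\mathrm{Par}^k$ is the set of partitions with largest part $\le k$; $\ell(\cdot)$ denotes the number of nonzero parts. For $\lambda\in\mathbb Z^\ell$, $\Delta^k(\lambda)=\{(i,j)\in\Delta^+_\ell:k-\lambda_i+i<j\}$. Hook length of a box (English notation): number of boxes below it in its column plus those weakly to its right in its row. A $(k+1)$-core is a partition with no box of hook length $k+1$; $\mathfrak p(\kappa)$ has $r$-th part equal to the number of boxes in row $r$ of $\kappa$ with hook length $\le k$, a bijection from $(k+1)$-cores to $\mathrm{Par}^k$. The $k$-skew diagram of $\lambda$ is the subdiagram of $\kappa=\mathfrak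 p^{ -1}(\lambda)$ consisting of the boxes with hook length $\le k$; it is a skew shape $\kappa/\eta$ with $\eta$ a partition, whose row lengths are $\lambda$. Let $\mu_c$ be the number of boxes in column $c$ of $\kappa/\eta$. Then $\Phi(\kappa/\eta)=\{(i,j)\in\Delta^+_{\ell(\kappa)}: i\le\ell(\eta)\text{ and } j\ge\mu_{\eta_i}+i\}$. -}

module Defs where

open import Level using (Level)
open import Data.Nat as ℕ using (ℕ; zero; suc; _∸_; _≤_; _<_)
import Data.Nat.Properties as ℕP
open import Data.Integer as ℤ using (ℤ; +_; -[1+_])
import Data.Integer.Properties as ℤP
open import Data.Fin as Fin using (Fin; toℕ; punchIn)
import Data.Fin.Properties as FinP
open import Data.List using (List; []; _∷_; length; filter; upTo; map; concatMap; allFin)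
open import Data.List.Relation.Unary.All using (All)
open import Data.Product using (_×_; _,_)
open import Data.Bool using (if_then_else_)
open import Relation.Nullary using (¬_)
open import Relation.Nullary.Decidable using (_×-dec_; ⌊_⌋)
open import Relation.Binary.PropositionalEquality using (_≡_; _≢_)
open import Algebra.Bundles using (CommutativeRing)

nth : List ℕ → ℕ → ℕ
nth []       _       = 0
nth (x ∷ xs) zero    = x
nth (x ∷ xs) (suc r) = nth xs r

IsPartition : List ℕ → Set
IsPartition xs = All (0 <_) xs × (∀ r → nth xs (suc r) ≤ nth xs r)

InPar : ℕ → List ℕ → Set
InPar k xs = IsPartition xs × All (_≤ k) xs

count : {A : Set} {P : A → Set} → ((a : A) → Relation.Nullary.Dec (P a)) → List A → ℕ
count P? xs = length (filter P? xs)

-- Young diagrams (English notation, 0-based rows r and columns c).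

colLen : List ℕ → ℕ → ℕ
colLen κ c = count (c ℕ.<?_) κ

-- hook length of box (r , c): boxes below it in its column plus
-- boxes weakly to its right in its row
hook : List ℕ → ℕ → ℕ → ℕ
hook κ r c = (colLen κ c ∸ suc r) ℕ.+ (nth κ r ∸ c)

IsCore : ℕ → List ℕ → Set
IsCore k κ = ∀ r c → r < length κ → c < nth κ r → hook κ r c ≢ suc k

pPart : ℕ → List ℕ → ℕ → ℕ
pPart k κ r = count (λ c → hook κ r c ℕ.≤? k) (upTo (nth κ r))

-- The k-skew diagram κ/η of λ (with λ = 𝔭(κ)):  η_r = κ_r - λ_r.

etaN : List ℕ → List ℕ → ℕ → ℕ
etaN κ lam r = nth κ r ∸ nth lam r

lenEta : List ℕ → List ℕ → ℕ
lenEta κ lam = count (λ r → 0 ℕ.<? etaN κ lam r) (upTo (length κ))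

-- μ_c (c a 1-based column index): number of boxes of κ/η in column c
mu : List ℕ → List ℕ → ℕ → ℕ
mu κ lam c = count (λ r → (etaN κ lam r ℕ.<? c) ×-dec (c ℕ.≤? nth κ r)) (upTo (length κ))

-- Root ideals, as lists of pairs of 0-based indices in Fin ℓ.

allPairs : (ℓ : ℕ) → List (Fin ℓ × Fin ℓ)
allPairs ℓ = concatMap (λ i → map (i ,_) (allFin ℓ)) (allFin ℓ)

lamVec : (κ lam : List ℕ) → Fin (length κ) → ℤ
lamVec κ lam i = + nth lam (toℕ i)

-- Δ^k(λ) ⊂ Δ^+_{ℓ(κ)}: pairs i < j (1-based) with k - λ_i + i < j
DeltaK : ℕ → (κ lam : List ℕ) → List (Fin (length κ) × Fin (length κ))
DeltaK k κ lam = filter P? (allPairs (length κ))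
  where
  P? : (p : Fin (length κ) × Fin (length κ)) → _
  P? (i , j) = (toℕ i ℕ.<? toℕ j) ×-dec
               (((+ k) ℤ.- lamVec κ lam i ℤ.+ (+ suc (toℕ i))) ℤ.<? (+ suc (toℕ j)))

-- Φ(κ/η) ⊂ Δ^+_{ℓ(κ)}: pairs i < j (1-based) with i ≤ ℓ(η) and j ≥ μ_{η_i} + i
PhiK : (κ lam : List ℕ) → List (Fin (length κ) × Fin (length κ))
PhiK κ lam = filter P? (allPairs (length κ))
  where
  P? : (p : Fin (length κ) × Fin (length κ)) → _
  P? (i , j) = (toℕ i ℕ.<? toℕ j) ×-dec
               ((suc (toℕ i) ℕ.≤? lenEta κ lam) ×-dec
                ((mu κ lam (etaN κ lam (toℕ i)) ℕ.+ suc (toℕ i)) ℕ.≤? suc (toℕ j)))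

-- Symmetric functions, via the complete homogeneous generators.
-- Λ = ℤ[h₁,h₂,…] is free on the h_d; an identity holds in Λ iff it holds
-- for every commutative ring R and every choice of values h : ℕ → R
-- (h d is the value of h_{d+1}).

module SymFun {c ℓ : Level} (R : CommutativeRing c ℓ) (h : ℕ → CommutativeRing.Carrier R) where
  open CommutativeRing R

  hz : ℤ → Carrier
  hz (+ zero)  = 1#
  hz (+ suc n) = h n
  hz -[1+ n ]  = 0#

  sumFin : ∀ n → (Fin n → Carrier) → Carrier
  sumFin zero    f = 0#
  sumFin (suc n) f = f Fin.zero + sumFin n (λ i → f (Fin.suc i))

  sgn : ℕ → Carrier
  sgn zero    = 1#
  sgn (suc n) = - sgn n

  det : ∀ n → (Fin n → Fin n → Carrier) → Carrier
  det zero    M = 1#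
  det (suc n) M = sumFin (suc n) (λ j →
    sgn (toℕ j) * M Fin.zero j * det n (λ a b → M (Fin.suc a) (punchIn j b)))

  s : ∀ {ℓ'} → (Fin ℓ' → ℤ) → Carrier
  s {ℓ'} γ = det ℓ' (λ i j → hz (γ i ℤ.+ (+ toℕ j) ℤ.- (+ toℕ i)))

  sumList : List Carrier → Carrier
  sumList []       = 0#
  sumList (x ∷ xs) = x + sumList xs

  shift : ∀ {ℓ'} → Fin ℓ' → Fin ℓ' → ℕ → (Fin ℓ' → ℤ) → Fin ℓ' → ℤ
  shift i j a γ m =
    γ m ℤ.+ (if ⌊ m Fin.≟ i ⌋ then + a else + 0)
        ℤ.- (if ⌊ m Fin.≟ j ⌋ then + a else + 0)

  -- coefficient of t^d in H(Ψ;γ) = ∏_{(i,j)∈Ψ} (1 - t R_ij)^{-1} s_γ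
  coeffH : ∀ {ℓ'} → List (Fin ℓ' × Fin ℓ') → ℕ → (Fin ℓ' → ℤ) → Carrier
  coeffH []            zero    γ = s γ
  coeffH []            (suc d) γ = 0#
  coeffH ((i , j) ∷ Ψ) d       γ =
    sumList (map (λ a → coeffH Ψ (d ∸ a) (shift i j a γ)) (upTo (suc d)))

{-# OPTIONS --safe #-}

-- Number rows and columns from 0, and let row r of Δ^k(λ) begin in column D r and row r of
-- Φ(κ/η) in column P r.  Since κ is a (k+1)-core, row D r of κ has length η r; it follows that
-- D r ≤ P r and that the rows D r, …, P r of κ all have this length.  Treating the rows of the
-- root ideal from the last to the first, we push the beginning of row i from D i to P i, one
-- root at a time.  Removing the root β = (i , j) changes H(Ψ;λ) by t H(Ψ;λ+ε_i-ε_j).  In this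
-- function the rows j and j+1, of equal length in κ and hence in λ, have become a defect
-- γ_j = γ_{j+1} - 1, and columns j and j+1 of Ψ agree.  If rows j and j+1 of Ψ agreed too, the
-- function would vanish, s being alternating.  In general the rows begin in consecutive columns
-- j', j'+1 with κ_{j'} = κ_{j'+1}, and one follows the bounce path j, j', … until it ends.

module Submission where

open import Defs
open import Level using (Level)
open import Data.Nat using (ℕ; _≤_)
open import Data.List using (List; length)
open import Relation.Binary.PropositionalEquality using (_≡_)
open import Algebra.Bundles using (CommutativeRing)

open import Algebra.Bundles using (module CommutativeMonoid)
import Algebra.Properties.Ring
open import Data.Bool using (true; false; if_then_else_)
open import Data.Fin as Fin using (Fin; zero; suc; toℕ; fromℕ<; punchIn; inject₁)
open import Data.Fin.Permutation.Components using (transpose)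
import Data.Fin.Properties as FinP
open import Data.Integer as ℤ using (ℤ; +_)
import Data.Integer.Properties as ℤP
open import Data.Integer.Tactic.RingSolver using (solve-∀)
open import Data.List
  using ([]; _∷_; _++_; map; filter; concatMap; upTo; applyUpTo; allFin; cartesianProduct)
open import Data.List.Membership.Propositional using (_∈_)
open import Data.List.Membership.Propositional.Properties
  using (∈-∃++; ∈-filter⁺; ∈-filter⁻; ∈-cartesianProduct⁺; ∈-allFin)
open import Data.List.Membership.Propositional.Properties.WithK using (unique∧set⇒bag)
open import Data.List.Properties
  using (filter-≐; filter-++; filter-accept; filter-reject; length-++; length-filter; upTo-∷ʳ)
open import Data.List.Relation.Binary.BagAndSetEquality using (∼bag⇒↭)
open import Data.List.Relation.Binary.Permutation.Propositional as Perm
  using (_↭_; ↭-sym; ↭-prep; ↭-trans; ↭-reflexive)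
import Data.List.Relation.Binary.Permutation.Propositional.Properties as PermP
import Data.List.Relation.Binary.Permutation.Setoid.Properties as PermS
open import Data.List.Relation.Unary.All using (All; []; _∷_)
open import Data.List.Relation.Unary.All.Properties using (¬Any⇒All¬)
import Data.List.Relation.Unary.AllPairs as AllPairs
open import Data.List.Relation.Unary.Any using (here; there)
open import Data.List.Relation.Unary.Unique.Propositional using (Unique; []; _∷_)
open import Data.List.Relation.Unary.Unique.Propositional.Properties
  using (cartesianProduct⁺; allFin⁺; filter⁺; Unique[x∷xs]⇒x∉xs)
open import Data.Nat as ℕ using (zero; suc; _<_; _∸_; z≤n; s≤s)
import Data.Nat.Properties as ℕP
open import Data.Product using (_×_; _,_; proj₁; proj₂; ∃)
open import Data.Product.Properties using (≡-dec)
open import Data.Sum using (_⊎_; inj₁; inj₂)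
open import Function using (mk⇔)
open import Relation.Binary.Definitions using (tri<; tri≈; tri>)
open import Relation.Binary.PropositionalEquality as ≡ using (_≢_)
import Relation.Binary.Reasoning.Setoid
open import Relation.Nullary using (¬_; Dec; yes; no; contradiction)
open import Relation.Nullary.Decidable using (⌊_⌋; dec-true; dec-false)

-- The Jacobi-Trudi determinant is alternating

-- The tool is (1 - tR)^(-1) = 1 + tR (1 - tR)^(-1): each use trades a weight for a shifted one at
-- the cost of a factor t, so vanishing is proved coefficient by coefficient, by induction on the
-- degree. Rows are handled last to first because then the columns below n in which rows begin stay
-- strictly increasing. While row i begins in column j < P i, no row begins in column j + 1; this is
-- why columns j and j + 1 agree. The bounce path is kept going by κ rather than by λ. As η is
-- decreasing, equal rows of κ have equal rows in η as well as in λ. Equal η means equal μ, so the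
-- two rows of Φ begin in consecutive columns j' and j' + 1, and rows j' and j' + 1 of κ both have
-- the length η_j. If η_j = 0, both rows of Φ are empty, hence agree, and the path ends. In `R` the
-- element 2 may be a zero divisor, so a change of sign under the reflection does not give zero at a
-- weight fixed by it. Vanishing at fixed weights is carried along as a statement of its own, from
-- the determinant upwards.

punchIn-inject₁-≤ : ∀ {m} (j k : Fin m) → toℕ j ≤ toℕ k → punchIn (inject₁ j) k ≡ suc k
punchIn-inject₁-≤ zero    k       _       = ≡.refl
punchIn-inject₁-≤ (suc j) (suc k) (s≤s p) = ≡.cong suc (punchIn-inject₁-≤ j k p)

punchIn-suc-≤ : ∀ {m} (j k : Fin m) → toℕ j ≤ toℕ k → punchIn (suc k) j ≡ inject₁ j
punchIn-suc-≤ zero    k       _       = ≡.refl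
punchIn-suc-≤ (suc j) (suc k) (s≤s p) = ≡.cong suc (punchIn-suc-≤ j k p)

-- The cosimplicial identity. It identifies the minors of two transposed terms of the expansion
-- along two rows.
punchIn-punchIn : ∀ {m} (j k : Fin (suc m)) → toℕ j ≤ toℕ k → (b : Fin m) →
  punchIn (inject₁ j) (punchIn k b) ≡ punchIn (suc k) (punchIn j b)
punchIn-punchIn zero    k       _       b       = ≡.refl
punchIn-punchIn (suc j) (suc k) _       zero    = ≡.refl
punchIn-punchIn (suc j) (suc k) (s≤s p) (suc b) = ≡.cong suc (punchIn-punchIn j k p b)

module Determinant {c ℓ : Level} (R : CommutativeRing c ℓ) (h : ℕ → CommutativeRing.Carrier R) where
  open CommutativeRing R hiding (zero)
  open SymFun R h
  open Algebra.Properties.Ring ring using (-‿distribˡ-*)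
  open import Algebra.Properties.CommutativeSemigroup
    (CommutativeMonoid.commutativeSemigroup +-commutativeMonoid)
    using (interchange)
  open import Algebra.Properties.CommutativeSemigroup
    (CommutativeMonoid.commutativeSemigroup *-commutativeMonoid)
    using (x∙yz≈y∙xz)
  open Relation.Binary.Reasoning.Setoid setoid

  sumFin-cong : ∀ n (f g : Fin n → Carrier) → (∀ i → f i ≈ g i) → sumFin n f ≈ sumFin n g
  sumFin-cong zero    f g e = refl
  sumFin-cong (suc n) f g e = +-cong (e zero) (sumFin-cong n _ _ (λ i → e (suc i)))

  sumFin-0# : ∀ n → sumFin n (λ _ → 0#) ≈ 0#
  sumFin-0# zero    = refl
  sumFin-0# (suc n) = trans (+-identityˡ _) (sumFin-0# n)

  sumFin-zero : ∀ n (f : Fin n → Carrier) → (∀ i → f i ≈ 0#) → sumFin n f ≈ 0#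
  sumFin-zero n f e = trans (sumFin-cong n f (λ _ → 0#) e) (sumFin-0# n)

  sumFin-+ : ∀ n (f g : Fin n → Carrier) → sumFin n f + sumFin n g ≈ sumFin n (λ i → f i + g i)
  sumFin-+ zero    f g = +-identityˡ 0#
  sumFin-+ (suc n) f g = trans (interchange _ _ _ _) (+-congˡ (sumFin-+ n (λ i → f (suc i)) (λ i → g (suc i))))

  *-sumFin : ∀ n x (f : Fin n → Carrier) → x * sumFin n f ≈ sumFin n (λ i → x * f i)
  *-sumFin zero    x f = zeroʳ x
  *-sumFin (suc n) x f = trans (distribˡ _ _ _) (+-congˡ (*-sumFin n x (λ i → f (suc i))))

  -- The pairs (j , punchIn j k) and (k' , punchIn k' j) with k' = suc k, j ≤ k,
  -- are each other's transposes and exhaust the off-diagonal positions.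
  sumFin-antisym : ∀ m (F : Fin (suc m) → Fin m → Carrier) →
    (∀ j k → toℕ j ≤ toℕ k → F (inject₁ j) k + F (suc k) j ≈ 0#) →
    sumFin (suc m) (λ j → sumFin m (F j)) ≈ 0#
  sumFin-antisym zero    F _ = +-identityˡ 0#
  sumFin-antisym (suc m) F e = begin
    sumFin (suc m) (F zero) + sumFin (suc m) (λ j → F (suc j) zero + sumFin m (λ k → F (suc j) (suc k)))
      ≈⟨ +-congˡ (sumFin-+ (suc m) column inner) ⟨
    sumFin (suc m) (F zero) + (sumFin (suc m) column + sumFin (suc m) inner)
      ≈⟨ +-assoc _ _ _ ⟨
    sumFin (suc m) (F zero) + sumFin (suc m) column + sumFin (suc m) inner
      ≈⟨ +-cong (trans (sumFin-+ (suc m) (F zero) column)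
                       (sumFin-zero (suc m) (λ k → F zero k + column k) (λ k → e zero k z≤n)))
                (sumFin-antisym m (λ j k → F (suc j) (suc k)) (λ j k p → e (suc j) (suc k) (s≤s p))) ⟩
    0# + 0# ≈⟨ +-identityˡ 0# ⟩
    0# ∎
    where
    column inner : Fin (suc m) → Carrier
    column j = F (suc j) zero
    inner  j = sumFin m (λ k → F (suc j) (suc k))

  Matrix : ℕ → Set c
  Matrix n = Fin n → Fin n → Carrier

  minor : ∀ {n} → Matrix (suc n) → Fin (suc n) → Matrix n
  minor M j a b = M (suc a) (punchIn j b)

  cofactor : ∀ {n} → Matrix (suc n) → Fin (suc n) → Carrier
  cofactor {n} M j = sgn (toℕ j) * M zero j * det n (minor M j)

  det-cong : ∀ n (M N : Matrix n) → (∀ a b → M a b ≈ N a b) → det n M ≈ det n N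
  det-cong zero    M N e = refl
  det-cong (suc n) M N e = sumFin-cong (suc n) (cofactor M) (cofactor N) λ j →
    *-cong (*-congˡ (e zero j)) (det-cong n (minor M j) (minor N j) (λ a b → e (suc a) (punchIn j b)))

  sgn-inject₁ : ∀ {n} (j : Fin n) → sgn (toℕ (inject₁ j)) ≈ sgn (toℕ j)
  sgn-inject₁ zero    = refl
  sgn-inject₁ (suc j) = -‿cong (sgn-inject₁ j)

  minor₂ : ∀ {n} → Matrix (suc (suc n)) → Fin (suc (suc n)) → Fin (suc n) → Carrier
  minor₂ {n} M j k = det n (λ a b → M (suc (suc a)) (punchIn j (punchIn k b)))

  laplace₂ : ∀ {n} → Matrix (suc (suc n)) → Fin (suc (suc n)) → Fin (suc n) → Carrier
  laplace₂ M j k =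
    (sgn (toℕ j) * M zero j) * ((sgn (toℕ k) * M (suc zero) (punchIn j k)) * minor₂ M j k)

  det-laplace₂ : ∀ {n} (M : Matrix (suc (suc n))) →
    det (suc (suc n)) M ≈ sumFin (suc (suc n)) (λ j → sumFin (suc n) (laplace₂ M j))
  det-laplace₂ {n} M = sumFin-cong (suc (suc n)) (cofactor M)
    (λ j → sumFin (suc n) (laplace₂ M j))
    (λ j → *-sumFin (suc n) (sgn (toℕ j) * M zero j) (cofactor (minor M j)))

  -- Both terms use columns j and k + 1 for the first two rows, in opposite order, and the signs
  -- belong to j + k and to (k + 1) + j. Taking `N` equal to `M` covers a matrix whose first two
  -- rows are equal.
  laplace₂-swap : ∀ {n} (M N : Matrix (suc (suc n))) →
    (∀ b → N zero b ≈ M (suc zero) b) → (∀ b → N (suc zero) b ≈ M zero b) →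
    (∀ a b → N (suc (suc a)) b ≈ M (suc (suc a)) b) →
    ∀ j k → toℕ j ≤ toℕ k → laplace₂ M (inject₁ j) k + laplace₂ N (suc k) j ≈ 0#
  laplace₂-swap {n} M N e₀ e₁ e j k p = begin
    laplace₂ M (inject₁ j) k + laplace₂ N (suc k) j
      ≈⟨ +-cong (*-cong (*-congʳ (sgn-inject₁ j)) (*-congʳ (*-congˡ (M₁ (punchIn-inject₁-≤ j k p)))))
                (*-cong (*-congˡ (e₀ (suc k)))
                        (*-cong (*-congˡ (trans (e₁ _) (M₀ (punchIn-suc-≤ j k p)))) minors)) ⟩
    (sj * a) * ((sk * b) * D) + (- sk * b) * ((sj * a) * D)
      ≈⟨ +-congˡ rearrange ⟩
    (sj * a) * ((sk * b) * D) + - ((sj * a) * ((sk * b) * D))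
      ≈⟨ -‿inverseʳ _ ⟩
    0# ∎
    where
    sj = sgn (toℕ j)
    sk = sgn (toℕ k)
    a  = M zero (inject₁ j)
    b  = M (suc zero) (suc k)
    D  = minor₂ M (inject₁ j) k
    M₀ : ∀ {x y} → x ≡ y → M zero x ≈ M zero y
    M₀ ≡.refl = refl
    M₁ : ∀ {x y} → x ≡ y → M (suc zero) x ≈ M (suc zero) y
    M₁ ≡.refl = refl
    minors : minor₂ N (suc k) j ≈ D
    minors = det-cong n _ _ λ x y → trans (e x _)
      (reflexive (≡.cong (M (suc (suc x))) (≡.sym (punchIn-punchIn j k p y))))
    rearrange : (- sk * b) * ((sj * a) * D) ≈ - ((sj * a) * ((sk * b) * D))
    rearrange = trans (*-congʳ (sym (-‿distribˡ-* sk b)))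
      (trans (sym (-‿distribˡ-* _ _)) (-‿cong (x∙yz≈y∙xz _ _ _)))

  det-swap : ∀ {n} (y y' : Fin n) → toℕ y' ≡ suc (toℕ y) → (M N : Matrix n) →
    (∀ b → N y b ≈ M y' b) → (∀ b → N y' b ≈ M y b) →
    (∀ a → a ≢ y → a ≢ y' → ∀ b → N a b ≈ M a b) →
    det n M + det n N ≈ 0#
  det-swap {suc (suc n)} zero (suc zero) _ M N e₀ e₁ e = begin
    det (suc (suc n)) M + det (suc (suc n)) N ≈⟨ +-cong (det-laplace₂ M) (det-laplace₂ N) ⟩
    sumFin (suc (suc n)) (λ j → sumFin (suc n) (laplace₂ M j))
      + sumFin (suc (suc n)) (λ j → sumFin (suc n) (laplace₂ N j))
      ≈⟨ sumFin-+ (suc (suc n)) (λ j → sumFin (suc n) (laplace₂ M j)) (λ j → sumFin (suc n) (laplace₂ N j)) ⟩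
    sumFin (suc (suc n)) (λ j → sumFin (suc n) (laplace₂ M j) + sumFin (suc n) (laplace₂ N j))
      ≈⟨ sumFin-cong (suc (suc n)) (λ j → sumFin (suc n) (laplace₂ M j) + sumFin (suc n) (laplace₂ N j))
           (λ j → sumFin (suc n) (λ k → laplace₂ M j k + laplace₂ N j k))
           (λ j → sumFin-+ (suc n) (laplace₂ M j) (laplace₂ N j)) ⟩
    sumFin (suc (suc n)) (λ j → sumFin (suc n) (λ k → laplace₂ M j k + laplace₂ N j k))
      -- The term of `M` at one position cancels that of `N` at the transposed one, and conversely.
      ≈⟨ sumFin-antisym (suc n) (λ j k → laplace₂ M j k + laplace₂ N j k)
           (λ j k p → trans (trans (+-congˡ (+-comm _ _)) (interchange _ _ _ _))
           (trans (+-cong (laplace₂-swap M N e₀ e₁ rest j k p)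
                          (laplace₂-swap N M (λ b → sym (e₁ b)) (λ b → sym (e₀ b))
                             (λ a b → sym (rest a b)) j k p)) (+-identityˡ 0#))) ⟩
    0# ∎
    where
    rest : ∀ a b → N (suc (suc a)) b ≈ M (suc (suc a)) b
    rest a = e (suc (suc a)) (λ ()) (λ ())
  det-swap {suc n} (suc y) (suc y') q M N e₀ e₁ e =
    trans (sumFin-+ (suc n) (cofactor M) (cofactor N))
      (sumFin-zero (suc n) (λ j → cofactor M j + cofactor N j) cancel)
    where
    cancel : ∀ j → cofactor M j + cofactor N j ≈ 0#
    cancel j = begin
      cofactor M j + cofactor N j
        ≈⟨ +-congˡ (*-congʳ (*-congˡ (e zero (λ ()) (λ ()) j))) ⟩
      sgn (toℕ j) * M zero j * det n (minor M j) + sgn (toℕ j) * M zero j * det n (minor N j)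
        ≈⟨ distribˡ _ _ _ ⟨
      sgn (toℕ j) * M zero j * (det n (minor M j) + det n (minor N j))
        ≈⟨ *-congˡ (det-swap y y' (ℕP.suc-injective q) (minor M j) (minor N j)
             (λ b → e₀ (punchIn j b)) (λ b → e₁ (punchIn j b))
             (λ a p p' b → e (suc a) (λ { ≡.refl → p ≡.refl }) (λ { ≡.refl → p' ≡.refl }) (punchIn j b))) ⟩
      sgn (toℕ j) * M zero j * 0# ≈⟨ zeroʳ _ ⟩
      0# ∎

  det-alt : ∀ {n} (y y' : Fin n) → toℕ y' ≡ suc (toℕ y) → (M : Matrix n) →
    (∀ b → M y b ≈ M y' b) → det n M ≈ 0#
  det-alt {suc (suc n)} zero (suc zero) _ M e = trans (det-laplace₂ M)
    (sumFin-antisym (suc n) (laplace₂ M) (laplace₂-swap M M e (λ b → sym (e b)) (λ _ _ → refl)))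
  det-alt {suc n} (suc y) (suc y') q M e = sumFin-zero (suc n) (cofactor M) λ j →
    trans (*-congˡ (det-alt y y' (ℕP.suc-injective q) (minor M j) (λ b → e (punchIn j b)))) (zeroʳ _)

-- Catalan functions

Weight : ℕ → Set
Weight n = Fin n → ℤ

Root : ℕ → Set
Root n = Fin n × Fin n

infix 4 _≗_
_≗_ : ∀ {n} → Weight n → Weight n → Set
γ ≗ δ = ∀ m → γ m ≡ δ m

-- The body repeats the conditional in `shift`, so that `shift i j a γ m` unfolds to
-- `γ m + unit i a m - unit j a m` by definition.
unit : ∀ {n} → Fin n → ℕ → Weight n
unit i a m = if ⌊ m Fin.≟ i ⌋ then + a else + 0

unit-same : ∀ {n} (i : Fin n) a → unit i a i ≡ + a
unit-same i a with i Fin.≟ i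
... | yes _   = ≡.refl
... | no  i≢i = contradiction ≡.refl i≢i

unit-other : ∀ {n} {i m : Fin n} a → m ≢ i → unit i a m ≡ + 0
unit-other {i = i} {m} a m≢i with m Fin.≟ i
... | yes m≡i = contradiction m≡i m≢i
... | no  _   = ≡.refl

move : ∀ {n} → Root n → Weight n → Weight n
move (i , j) γ m = γ m ℤ.+ unit i 1 m ℤ.- unit j 1 m

move-comm : ∀ {n} (α β : Root n) (γ : Weight n) → move α (move β γ) ≗ move β (move α γ)
move-comm (i , j) (k , l) γ m = lemma (γ m) (unit i 1 m) (unit j 1 m) (unit k 1 m) (unit l 1 m)
  where
  lemma : ∀ x a b c d → x ℤ.+ c ℤ.- d ℤ.+ a ℤ.- b ≡ x ℤ.+ a ℤ.- b ℤ.+ c ℤ.- d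
  lemma = solve-∀

transpose-left : ∀ {n} (i j : Fin n) → transpose i j i ≡ j
transpose-left i j rewrite dec-true (i Fin.≟ i) ≡.refl = ≡.refl

transpose-right : ∀ {n} (i j : Fin n) → i ≢ j → transpose i j j ≡ i
transpose-right i j i≢j
  rewrite dec-false (j Fin.≟ i) (λ e → i≢j (≡.sym e)) | dec-true (j Fin.≟ j) ≡.refl = ≡.refl

transpose-other : ∀ {n} {i j k : Fin n} → k ≢ i → k ≢ j → transpose i j k ≡ k
transpose-other {i = i} {j} {k} p q
  rewrite dec-false (k Fin.≟ i) p | dec-false (k Fin.≟ j) q = ≡.refl

transpose-elim : ∀ {n p} (i j : Fin n) (P : Fin n → Fin n → Set p) →
  P i j → P j i → (∀ k → k ≢ i → k ≢ j → P k k) → ∀ k → P k (transpose i j k)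
transpose-elim i j P pij pji pkk k with k Fin.≟ i
... | yes ≡.refl = pij
... | no k≢i with k Fin.≟ j
...   | yes ≡.refl = pji
...   | no k≢j = pkk k k≢i k≢j

module Operators {c ℓ : Level} (R : CommutativeRing c ℓ) (h : ℕ → CommutativeRing.Carrier R) (n : ℕ) where
  open CommutativeRing R hiding (zero)
  open SymFun R h
  open Determinant R h
  open import Algebra.Properties.CommutativeSemigroup
    (CommutativeMonoid.commutativeSemigroup +-commutativeMonoid)
    using (interchange; xy∙z≈xz∙y)
  open Relation.Binary.Reasoning.Setoid setoid

  shift-0 : ∀ (i j : Fin n) γ → shift i j 0 γ ≗ γ
  shift-0 i j γ m with ⌊ m Fin.≟ i ⌋ | ⌊ m Fin.≟ j ⌋
  ... | true  | true  = ≡.trans (ℤP.+-identityʳ _) (ℤP.+-identityʳ _)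
  ... | true  | false = ≡.trans (ℤP.+-identityʳ _) (ℤP.+-identityʳ _)
  ... | false | true  = ≡.trans (ℤP.+-identityʳ _) (ℤP.+-identityʳ _)
  ... | false | false = ≡.trans (ℤP.+-identityʳ _) (ℤP.+-identityʳ _)

  unit-suc : ∀ (i : Fin n) a m → unit i (suc a) m ≡ unit i 1 m ℤ.+ unit i a m
  unit-suc i a m with ⌊ m Fin.≟ i ⌋
  ... | true  = ≡.refl
  ... | false = ≡.refl

  shift-suc : ∀ (i j : Fin n) a γ → shift i j (suc a) γ ≗ shift i j a (move (i , j) γ)
  shift-suc i j a γ m rewrite unit-suc i a m | unit-suc j a m =
    lemma (γ m) (unit i 1 m) (unit j 1 m) (unit i a m) (unit j a m)
    where
    lemma : ∀ x p q r s → x ℤ.+ (p ℤ.+ r) ℤ.- (q ℤ.+ s) ≡ x ℤ.+ p ℤ.- q ℤ.+ r ℤ.- s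
    lemma = solve-∀

  shift-cong : ∀ (i j : Fin n) a {γ δ : Weight n} → γ ≗ δ → shift i j a γ ≗ shift i j a δ
  shift-cong i j a e m = ≡.cong (λ x → x ℤ.+ unit i a m ℤ.- unit j a m) (e m)

  s-cong : {γ δ : Weight n} → γ ≗ δ → s γ ≈ s δ
  s-cong e = det-cong n _ _ λ i j → reflexive (≡.cong (λ x → hz (x ℤ.+ + toℕ j ℤ.- + toℕ i)) (e i))

  sumList-cong : ∀ {f g : ℕ → Carrier} {p q : ℕ → ℕ} m → (∀ a → f (p a) ≈ g (q a)) →
    sumList (map f (applyUpTo p m)) ≈ sumList (map g (applyUpTo q m))
  sumList-cong zero    e = refl
  sumList-cong (suc m) e = +-cong (e 0) (sumList-cong m (λ a → e (suc a)))

  coeffH-cong : ∀ Ψ d {γ δ : Weight n} → γ ≗ δ → coeffH Ψ d γ ≈ coeffH Ψ d δ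
  coeffH-cong []            zero    e = s-cong e
  coeffH-cong []            (suc d) e = refl
  coeffH-cong ((i , j) ∷ Ψ) d       e =
    sumList-cong (suc d) (λ a → coeffH-cong Ψ (d ∸ a) (shift-cong i j a e))

  -- multiplication by t, on coefficient sequences
  delay : (ℕ → Carrier) → ℕ → Carrier
  delay f zero    = 0#
  delay f (suc d) = f d

  -- The geometric series: the summand a = 0 is split off, and one shift is taken out of all the
  -- others.
  coeffH-∷ : ∀ β Ψ d (γ : Weight n) →
    coeffH (β ∷ Ψ) d γ ≈ coeffH Ψ d γ + delay (λ e → coeffH (β ∷ Ψ) e (move β γ)) d
  coeffH-∷ (i , j) Ψ zero    γ = +-congʳ (coeffH-cong Ψ 0 (shift-0 i j γ))
  coeffH-∷ (i , j) Ψ (suc d) γ = +-cong (coeffH-cong Ψ (suc d) (shift-0 i j γ))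
    (sumList-cong (suc d) (λ a → coeffH-cong Ψ (d ∸ a) (shift-suc i j a γ)))

  coeffH-∷-cong : ∀ β Ψ Ψ' → (∀ d γ → coeffH Ψ d γ ≈ coeffH Ψ' d γ) →
    ∀ d (γ : Weight n) → coeffH (β ∷ Ψ) d γ ≈ coeffH (β ∷ Ψ') d γ
  coeffH-∷-cong (i , j) Ψ Ψ' e d γ = sumList-cong (suc d) (λ a → e (d ∸ a) (shift i j a γ))

  -- Both orders expand into the same four kinds of terms: no shift, either shift, both shifts.
  -- Shifts of weights commute, and each one lowers the degree, on which the induction runs.
  coeffH-swap : ∀ α β Ψ d (γ : Weight n) → coeffH (α ∷ β ∷ Ψ) d γ ≈ coeffH (β ∷ α ∷ Ψ) d γ
  delay-swap : ∀ α β Ψ d (γ : Weight n) →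
    delay (λ e → coeffH (α ∷ β ∷ Ψ) e γ) d ≈ delay (λ e → coeffH (β ∷ α ∷ Ψ) e γ) d

  delay-swap α β Ψ zero    γ = refl
  delay-swap α β Ψ (suc d) γ = coeffH-swap α β Ψ d γ

  delay-cong : ∀ Ψ d {γ δ : Weight n} → γ ≗ δ →
    delay (λ e → coeffH Ψ e γ) d ≈ delay (λ e → coeffH Ψ e δ) d
  delay-cong Ψ zero    e = refl
  delay-cong Ψ (suc d) e = coeffH-cong Ψ d e

  coeffH-swap α β Ψ zero    γ = begin
    coeffH (α ∷ β ∷ Ψ) 0 γ   ≈⟨ trans (coeffH-∷ α (β ∷ Ψ) 0 γ) (+-congʳ (coeffH-∷ β Ψ 0 γ)) ⟩
    coeffH Ψ 0 γ + 0# + 0#   ≈⟨ trans (coeffH-∷ β (α ∷ Ψ) 0 γ) (+-congʳ (coeffH-∷ α Ψ 0 γ)) ⟨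
    coeffH (β ∷ α ∷ Ψ) 0 γ   ∎
  coeffH-swap α β Ψ (suc d) γ = begin
    A (suc d) γ
      ≈⟨ trans (coeffH-∷ α (β ∷ Ψ) (suc d) γ) (+-congʳ (coeffH-∷ β Ψ (suc d) γ)) ⟩
    F + coeffH (β ∷ Ψ) d γβ + A d γα
      ≈⟨ +-congˡ (trans (coeffH-swap α β Ψ d γα) (coeffH-∷ β (α ∷ Ψ) d γα)) ⟩
    F + coeffH (β ∷ Ψ) d γβ + (coeffH (α ∷ Ψ) d γα + delay (λ e → B e (move β γα)) d)
      ≈⟨ interchange _ _ _ _ ⟩
    F + coeffH (α ∷ Ψ) d γα + (coeffH (β ∷ Ψ) d γβ + delay (λ e → B e (move β γα)) d)
      ≈⟨ +-congˡ (+-congˡ (trans (delay-swap β α Ψ d (move β γα))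
           (delay-cong (α ∷ β ∷ Ψ) d (move-comm β α γ)))) ⟩
    F + coeffH (α ∷ Ψ) d γα + (coeffH (β ∷ Ψ) d γβ + delay (λ e → A e (move α γβ)) d)
      ≈⟨ +-congˡ (trans (coeffH-swap β α Ψ d γβ) (coeffH-∷ α (β ∷ Ψ) d γβ)) ⟨
    F + coeffH (α ∷ Ψ) d γα + B d γβ
      ≈⟨ trans (coeffH-∷ β (α ∷ Ψ) (suc d) γ) (+-congʳ (coeffH-∷ α Ψ (suc d) γ)) ⟨
    B (suc d) γ ∎
    where
    A B : ℕ → Weight n → Carrier
    A = coeffH (α ∷ β ∷ Ψ)
    B = coeffH (β ∷ α ∷ Ψ)
    F = coeffH Ψ (suc d) γ
    γα γβ : Weight n
    γα = move α γ
    γβ = move β γ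

  coeffH-↭ : ∀ {Ψ Ψ'} → Ψ ↭ Ψ' → ∀ d (γ : Weight n) → coeffH Ψ d γ ≈ coeffH Ψ' d γ
  coeffH-↭ Perm.refl         d γ = refl
  coeffH-↭ (Perm.prep {Ψ} {Ψ'} β p) d γ = coeffH-∷-cong β Ψ Ψ' (coeffH-↭ p) d γ
  coeffH-↭ (Perm.swap {Ψ} {Ψ'} α β p) d γ = trans (coeffH-swap α β Ψ d γ)
    (coeffH-∷-cong β (α ∷ Ψ) (α ∷ Ψ') (coeffH-∷-cong α Ψ Ψ' (coeffH-↭ p)) d γ)
  coeffH-↭ (Perm.trans p q)  d γ = trans (coeffH-↭ p d γ) (coeffH-↭ q d γ)

  -- Root sets and weights invariant under an adjacent transposition

  module Toggle (y y' : Fin n) (y'≡1+y : toℕ y' ≡ suc (toℕ y)) where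

    y≢y' : y ≢ y'
    y≢y' ≡.refl = ℕP.1+n≢n (≡.sym y'≡1+y)

    σ : Fin n → Fin n
    σ = transpose y y'

    σ-y : σ y ≡ y'
    σ-y = transpose-left y y'

    σ-y' : σ y' ≡ y
    σ-y' = transpose-right y y' y≢y'

    σ-involutive : ∀ i → σ (σ i) ≡ i
    σ-involutive = transpose-elim y y' (λ i j → σ j ≡ i) σ-y' σ-y (λ k p q → transpose-other p q)

    σᴿ : Root n → Root n
    σᴿ (i , j) = σ i , σ j

    σᴿ-involutive : ∀ β → σᴿ (σᴿ β) ≡ β
    σᴿ-involutive (i , j) = ≡.cong₂ _,_ (σ-involutive i) (σ-involutive j)

    -- In terms of m ↦ γ m - m, which straightens s γ: precomposition with σ.
    record Reflect (γ δ : Weight n) : Set where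
      constructor reflect
      field at : ∀ m → δ m ℤ.- + toℕ m ≡ γ (σ m) ℤ.- + toℕ (σ m)
    open Reflect

    unit-σ : ∀ i a m → unit (σ i) a m ≡ unit i a (σ m)
    unit-σ i a m with σ m Fin.≟ i
    ... | yes ≡.refl = ≡.trans (≡.cong (λ k → unit k a m) (σ-involutive m)) (unit-same m a)
    ... | no σm≢i = unit-other a λ { ≡.refl → σm≢i (σ-involutive i) }

    reflect-move : ∀ β {γ δ} → Reflect γ δ → Reflect (move β γ) (move (σᴿ β) δ)
    reflect-move (i , j) {γ} {δ} r = reflect λ m →
      ≡.trans (≡.cong₂ (λ u v → δ m ℤ.+ u ℤ.- v ℤ.- + toℕ m) (unit-σ i 1 m) (unit-σ j 1 m))
      (≡.trans (regroup (δ m) _ _ _)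
      (≡.trans (≡.cong (λ x → x ℤ.+ unit i 1 (σ m) ℤ.- unit j 1 (σ m)) (at r m))
      (≡.sym (regroup (γ (σ m)) _ _ _))))
      where
      regroup : ∀ x a b c → x ℤ.+ a ℤ.- b ℤ.- c ≡ x ℤ.- c ℤ.+ a ℤ.- b
      regroup = solve-∀

    reflect-congʳ : ∀ {γ δ ε} → δ ≗ ε → Reflect γ δ → Reflect γ ε
    reflect-congʳ e r = reflect λ m → ≡.trans (≡.cong (λ x → x ℤ.- + toℕ m) (≡.sym (e m))) (at r m)

    -- For δ = γ the first clause yields only F γ + F γ = 0, which is weaker than the second.
    record Alternating (F : Weight n → Carrier) : Set ℓ where
      field
        antisym : ∀ γ δ → Reflect γ δ → F γ + F δ ≈ 0#
        fixed   : ∀ γ → Reflect γ γ → F γ ≈ 0#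
    open Alternating

    s-alternating : Alternating s
    s-alternating = record
      { antisym = λ γ δ r → det-swap y y' y'≡1+y (entry γ) (entry δ)
          (λ b → reflexive (≡.trans (rows γ δ r y b) (≡.cong (λ a → entry γ a b) σ-y)))
          (λ b → reflexive (≡.trans (rows γ δ r y' b) (≡.cong (λ a → entry γ a b) σ-y')))
          (λ a p q b → reflexive (≡.trans (rows γ δ r a b)
             (≡.cong (λ a → entry γ a b) (transpose-other p q))))
      ; fixed = λ γ r → det-alt y y' y'≡1+y (entry γ)
          (λ b → reflexive (≡.trans (rows γ γ r y b) (≡.cong (λ a → entry γ a b) σ-y)))
      }
      where
      entry : Weight n → Matrix n
      entry γ a b = hz (γ a ℤ.+ + toℕ b ℤ.- + toℕ a)
      regroup : ∀ x a b → x ℤ.+ b ℤ.- a ≡ x ℤ.- a ℤ.+ b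
      regroup = solve-∀
      rows : ∀ γ δ → Reflect γ δ → ∀ a b → entry δ a b ≡ entry γ (σ a) b
      rows γ δ r a b = ≡.cong hz (≡.trans (regroup (δ a) (+ toℕ a) (+ toℕ b))
        (≡.trans (≡.cong (ℤ._+ + toℕ b) (at r a)) (≡.sym (regroup (γ (σ a)) (+ toℕ (σ a)) (+ toℕ b)))))

    alternating-0 : Alternating (λ _ → 0#)
    alternating-0 = record { antisym = λ _ _ _ → +-identityˡ 0# ; fixed = λ _ _ → refl }

    alternating-[] : ∀ d → Alternating (coeffH [] d)
    alternating-[] zero    = s-alternating
    alternating-[] (suc d) = alternating-0

    alternating-∷ : ∀ β Ψ → σᴿ β ≡ β → (∀ d → Alternating (coeffH Ψ d)) →
      ∀ d → Alternating (coeffH (β ∷ Ψ) d)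
    alternating-∷ β Ψ σβ≡β alt = go
      where
      preserved : ∀ {γ δ} → Reflect γ δ → Reflect (move β γ) (move β δ)
      preserved {γ} {δ} r = ≡.subst (λ α → Reflect (move β γ) (move α δ)) σβ≡β (reflect-move β {γ} {δ} r)
      go : ∀ d → Alternating (coeffH (β ∷ Ψ) d)
      go-delay : ∀ d → Alternating (λ γ → delay (λ e → coeffH (β ∷ Ψ) e γ) d)
      go-delay zero    = alternating-0
      go-delay (suc d) = go d
      go zero = record
        { antisym = λ γ δ r → trans (+-cong (coeffH-∷ β Ψ 0 γ) (coeffH-∷ β Ψ 0 δ))
            (trans (+-cong (+-identityʳ _) (+-identityʳ _)) (antisym (alt 0) γ δ r))
        ; fixed = λ γ r → trans (coeffH-∷ β Ψ 0 γ) (trans (+-identityʳ _) (fixed (alt 0) γ r)) }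
      go (suc d) = record
        { antisym = λ γ δ r → trans (+-cong (coeffH-∷ β Ψ (suc d) γ) (coeffH-∷ β Ψ (suc d) δ))
            (trans (interchange _ _ _ _)
            (trans (+-cong (antisym (alt (suc d)) γ δ r) (antisym (go d) (move β γ) (move β δ) (preserved r)))
            (+-identityˡ 0#)))
        ; fixed = λ γ r → trans (coeffH-∷ β Ψ (suc d) γ)
            (trans (+-cong (fixed (alt (suc d)) γ r) (fixed (go d) (move β γ) (preserved r))) (+-identityˡ 0#)) }

    -- (1 - tu)(1 - tv) F' = F, with u, v the shifts along α and β, solved for F'.
    coeffH-∷∷ : ∀ α β Ψ d (γ : Weight n) →
      coeffH (α ∷ β ∷ Ψ) (suc d) γ + delay (λ e → coeffH (α ∷ β ∷ Ψ) e (move α (move β γ))) d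
        ≈ coeffH Ψ (suc d) γ + (coeffH (α ∷ β ∷ Ψ) d (move β γ) + coeffH (α ∷ β ∷ Ψ) d (move α γ))
    coeffH-∷∷ α β Ψ d γ = begin
      coeffH (α ∷ β ∷ Ψ) (suc d) γ + D
        ≈⟨ +-congʳ (trans (coeffH-∷ α (β ∷ Ψ) (suc d) γ) (+-congʳ (coeffH-∷ β Ψ (suc d) γ))) ⟩
      coeffH Ψ (suc d) γ + coeffH (β ∷ Ψ) d (move β γ) + coeffH (α ∷ β ∷ Ψ) d (move α γ) + D
        ≈⟨ trans (xy∙z≈xz∙y _ _ _) (+-congʳ (+-assoc _ _ _)) ⟩
      coeffH Ψ (suc d) γ + (coeffH (β ∷ Ψ) d (move β γ) + D) + coeffH (α ∷ β ∷ Ψ) d (move α γ)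
        ≈⟨ +-congʳ (+-congˡ (coeffH-∷ α (β ∷ Ψ) d (move β γ))) ⟨
      coeffH Ψ (suc d) γ + coeffH (α ∷ β ∷ Ψ) d (move β γ) + coeffH (α ∷ β ∷ Ψ) d (move α γ)
        ≈⟨ +-assoc _ _ _ ⟩
      coeffH Ψ (suc d) γ + (coeffH (α ∷ β ∷ Ψ) d (move β γ) + coeffH (α ∷ β ∷ Ψ) d (move α γ)) ∎
      where
      D = delay (λ e → coeffH (α ∷ β ∷ Ψ) e (move α (move β γ))) d

    -- When β is not fixed by σ, its factor has to be taken together with that of σβ: the reflection
    -- exchanges the two linear terms of `coeffH-∷∷` and respects the mixed one.
    alternating-∷∷ : ∀ β Ψ → (∀ d → Alternating (coeffH Ψ d)) →
      ∀ d → Alternating (coeffH (β ∷ σᴿ β ∷ Ψ) d)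
    alternating-∷∷ β Ψ alt = go
      where
      β' = σᴿ β
      F' = coeffH (β ∷ β' ∷ Ψ)
      reflect₁ : ∀ {γ δ : Weight n} → Reflect γ δ → Reflect (move β γ) (move β' δ)
      reflect₁ {γ} {δ} = reflect-move β {γ} {δ}
      reflect₂ : ∀ {γ δ} → Reflect γ δ → Reflect (move β' γ) (move β δ)
      reflect₂ {γ} {δ} r =
        ≡.subst (λ α → Reflect (move β' γ) (move α δ)) (σᴿ-involutive β) (reflect-move β' {γ} {δ} r)
      reflect₁₂ : ∀ {γ δ} → Reflect γ δ → Reflect (move β (move β' γ)) (move β (move β' δ))
      reflect₁₂ {γ} {δ} r = reflect-congʳ (move-comm β' β δ) (reflect₁ (reflect₂ r))
      go : ∀ d → Alternating (F' d)
      go-delay : ∀ d → Alternating (λ γ → delay (λ e → F' e γ) d)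
      go-delay zero    = alternating-0
      go-delay (suc d) = go d
      expand₀ : ∀ γ → F' 0 γ ≈ coeffH Ψ 0 γ
      expand₀ γ = trans (coeffH-∷ β (β' ∷ Ψ) 0 γ) (trans (+-identityʳ _)
        (trans (coeffH-∷ β' Ψ 0 γ) (+-identityʳ _)))
      go zero = record
        { antisym = λ γ δ r → trans (+-cong (expand₀ γ) (expand₀ δ)) (antisym (alt 0) γ δ r)
        ; fixed   = λ γ r → trans (expand₀ γ) (fixed (alt 0) γ r) }
      go (suc d) = record
        { antisym = λ γ δ r → begin
            F' (suc d) γ + F' (suc d) δ
              ≈⟨ trans (+-congˡ (antisym (go-delay d) (move β (move β' γ)) (move β (move β' δ)) (reflect₁₂ r))) (+-identityʳ _) ⟨
            F' (suc d) γ + F' (suc d) δ + (delay (λ e → F' e (move β (move β' γ))) d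
              + delay (λ e → F' e (move β (move β' δ))) d)
              ≈⟨ interchange _ _ _ _ ⟩
            F' (suc d) γ + delay (λ e → F' e (move β (move β' γ))) d
              + (F' (suc d) δ + delay (λ e → F' e (move β (move β' δ))) d)
              ≈⟨ +-cong (coeffH-∷∷ β β' Ψ d γ) (coeffH-∷∷ β β' Ψ d δ) ⟩
            coeffH Ψ (suc d) γ + (F' d (move β' γ) + F' d (move β γ))
              + (coeffH Ψ (suc d) δ + (F' d (move β' δ) + F' d (move β δ)))
              ≈⟨ trans (interchange _ _ _ _) (+-congˡ (trans (+-congˡ (+-comm _ _)) (interchange _ _ _ _))) ⟩
            coeffH Ψ (suc d) γ + coeffH Ψ (suc d) δ
              + (F' d (move β' γ) + F' d (move β δ) + (F' d (move β γ) + F' d (move β' δ)))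
              ≈⟨ +-cong (antisym (alt (suc d)) γ δ r)
                   (+-cong (antisym (go d) (move β' γ) (move β δ) (reflect₂ r))
                           (antisym (go d) (move β γ) (move β' δ) (reflect₁ r))) ⟩
            0# + (0# + 0#) ≈⟨ trans (+-identityˡ _) (+-identityˡ 0#) ⟩
            0# ∎
        ; fixed = λ γ r → begin
            F' (suc d) γ
              ≈⟨ trans (+-congˡ (fixed (go-delay d) (move β (move β' γ)) (reflect₁₂ r))) (+-identityʳ _) ⟨
            F' (suc d) γ + delay (λ e → F' e (move β (move β' γ))) d
              ≈⟨ coeffH-∷∷ β β' Ψ d γ ⟩
            coeffH Ψ (suc d) γ + (F' d (move β' γ) + F' d (move β γ))
              -- At a fixed weight the two linear terms are reflections of each other, so they
              -- cancel by `antisym`; neither need vanish alone.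
              ≈⟨ +-cong (fixed (alt (suc d)) γ r) (antisym (go d) (move β' γ) (move β γ) (reflect₂ r)) ⟩
            0# + 0# ≈⟨ +-identityˡ 0# ⟩
            0# ∎ }

    alternating-↭ : ∀ {Ψ Ψ'} d → Ψ ↭ Ψ' → Alternating (coeffH Ψ' d) → Alternating (coeffH Ψ d)
    alternating-↭ d p alt = record
      { antisym = λ γ δ r → trans (+-cong (coeffH-↭ p d γ) (coeffH-↭ p d δ)) (antisym alt γ δ r)
      ; fixed   = λ γ r → trans (coeffH-↭ p d γ) (fixed alt γ r) }

    _≟ᴿ_ : (α β : Root n) → Dec (α ≡ β)
    _≟ᴿ_ = ≡-dec Fin._≟_ Fin._≟_

    Closed : List (Root n) → Set
    Closed Ψ = ∀ {β} → β ∈ Ψ → σᴿ β ∈ Ψ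

    -- The order of the roots is immaterial, so the σ-orbit of the first root, of size one or two,
    -- can be split off. Uniqueness makes the rest closed again. That rest is not a tail of the list
    -- when the orbit has two elements; hence the bound `N` for the recursion.
    alternating-closed : ∀ N Ψ → length Ψ ≤ N → Unique Ψ → Closed Ψ → ∀ d → Alternating (coeffH Ψ d)
    alternating-closed _       []      _       _ _ = alternating-[]
    alternating-closed (suc N) (β ∷ Ψ) (s≤s Ψ≤N) u@(_ ∷ uΨ) cl d with σᴿ β ≟ᴿ β
    ... | yes σβ≡β = alternating-∷ β Ψ σβ≡β (alternating-closed N Ψ Ψ≤N uΨ closed) d
      where
      closed : Closed Ψ
      closed {α} α∈Ψ with cl (there α∈Ψ)
      ... | there σα∈Ψ = σα∈Ψ
      ... | here σα≡β = contradiction (≡.subst (_∈ Ψ) α≡β α∈Ψ) (Unique[x∷xs]⇒x∉xs u)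
        where
        α≡β : α ≡ β
        α≡β = ≡.trans (≡.sym (σᴿ-involutive α)) (≡.trans (≡.cong σᴿ σα≡β) σβ≡β)
    ... | no σβ≢β with cl (here ≡.refl)
    ...   | here σβ≡β = contradiction σβ≡β σβ≢β
    ...   | there σβ∈Ψ with xs , ys , Ψ≡ ← ∈-∃++ σβ∈Ψ =
      alternating-↭ d (↭-prep β Ψ↭) (alternating-∷∷ β Φ (alternating-closed N Φ Φ≤N uΦ closed) d)
      where
      Φ = xs ++ ys
      Ψ↭ : Ψ ↭ σᴿ β ∷ Φ
      Ψ↭ = ↭-trans (↭-reflexive Ψ≡) (PermP.shift (σᴿ β) xs ys)
      unique : Unique (β ∷ σᴿ β ∷ Φ)
      unique = PermS.Unique-resp-↭ (≡.setoid (Root n)) (Perm.↭⇒↭ₛ (↭-prep β Ψ↭)) u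
      uΦ : Unique Φ
      uΦ with _ ∷ _ ∷ v ← unique = v
      Φ≤N : length Φ ≤ N
      Φ≤N = ℕP.≤-trans (ℕP.n≤1+n _) (≡.subst (_≤ N) (PermP.↭-length Ψ↭) Ψ≤N)
      closed : Closed Φ
      closed {α} α∈Φ with PermP.∈-resp-↭ (↭-prep β Ψ↭) (cl (PermP.∈-resp-↭ (↭-sym (↭-prep β Ψ↭)) (there (there α∈Φ))))
      ... | there (there σα∈Φ) = σα∈Φ
      ... | here σα≡β = contradiction (≡.subst (_∈ Φ) (≡.trans (≡.sym (σᴿ-involutive α)) (≡.cong σᴿ σα≡β)) α∈Φ)
                          (Unique[x∷xs]⇒x∉xs (AllPairs.tail unique))
      ... | there (here σα≡σβ) = contradiction
              (there (≡.subst (_∈ Φ) (≡.trans (≡.sym (σᴿ-involutive α)) (≡.trans (≡.cong σᴿ σα≡σβ) (σᴿ-involutive β))) α∈Φ))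
              (Unique[x∷xs]⇒x∉xs unique)

    -- `Reflect γ γ` amounts to γ_{y'} = γ_y + 1, the defect that makes two adjacent rows of the
    -- Jacobi-Trudi matrix equal.
    toggle : ∀ Ψ → Unique Ψ → Closed Ψ → ∀ d γ → Reflect γ γ → coeffH Ψ d γ ≈ 0#
    toggle Ψ u cl d = fixed (alternating-closed (length Ψ) Ψ ℕP.≤-refl u cl d)

-- Root ideals and the mirror lemma

allPairs-cartesian : ∀ n → allPairs n ≡ cartesianProduct (allFin n) (allFin n)
allPairs-cartesian n = go (allFin n)
  where
  go : ∀ (is : List (Fin n)) → concatMap (λ i → map (i ,_) (allFin n)) is ≡ cartesianProduct is (allFin n)
  go []       = ≡.refl
  go (i ∷ is) = ≡.cong (map (i ,_) (allFin n) ++_) (go is)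

allPairs-unique : ∀ n → Unique (allPairs n)
allPairs-unique n = ≡.subst Unique (≡.sym (allPairs-cartesian n)) (cartesianProduct⁺ (allFin⁺ n) (allFin⁺ n))

∈-allPairs : ∀ {n} (β : Root n) → β ∈ allPairs n
∈-allPairs {n} (i , j) =
  ≡.subst ((i , j) ∈_) (≡.sym (allPairs-cartesian n)) (∈-cartesianProduct⁺ (∈-allFin i) (∈-allFin j))

_[_≔_] : (ℕ → ℕ) → ℕ → ℕ → ℕ → ℕ
(f [ a ≔ b ]) r with r ℕ.≟ a
... | yes _ = b
... | no  _ = f r

≔-same : ∀ f a b → (f [ a ≔ b ]) a ≡ b
≔-same f a b with a ℕ.≟ a
... | yes _  = ≡.refl
... | no a≢a = contradiction ≡.refl a≢a

≔-other : ∀ f {a} b {r} → r ≢ a → (f [ a ≔ b ]) r ≡ f r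
≔-other f {a} b {r} r≢a with r ℕ.≟ a
... | yes r≡a = contradiction r≡a r≢a
... | no  _   = ≡.refl

-- A root ideal is encoded by the first column of each row; a value of at least `n` means an empty
-- row. The condition i < j turns into r < f r, supplied for both ideals by `r<D` and `D≤P`.
roots : ∀ {n} → (ℕ → ℕ) → List (Root n)
roots {n} f = filter (λ (i , j) → f (toℕ i) ℕ.≤? toℕ j) (allPairs n)

module _ {n : ℕ} where

  roots-cong : ∀ {f g} → (∀ r → r < n → f r ≡ g r) → roots {n} f ≡ roots g
  roots-cong e = filter-≐ _ _
    ( (λ {β} → ≡.subst (_≤ toℕ (proj₂ β)) (e _ (FinP.toℕ<n (proj₁ β))))
    , (λ {β} → ≡.subst (_≤ toℕ (proj₂ β)) (≡.sym (e _ (FinP.toℕ<n (proj₁ β))))) ) (allPairs n)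

  roots-unique : ∀ f → Unique (roots {n} f)
  roots-unique f = filter⁺ _ (allPairs-unique n)

  ∈-roots⁺ : ∀ f (i j : Fin n) → f (toℕ i) ≤ toℕ j → (i , j) ∈ roots f
  ∈-roots⁺ f i j p = ∈-filter⁺ (λ (i , j) → f (toℕ i) ℕ.≤? toℕ j) (∈-allPairs (i , j)) p

  ∈-roots⁻ : ∀ f (i j : Fin n) → (i , j) ∈ roots f → f (toℕ i) ≤ toℕ j
  ∈-roots⁻ f i j p = proj₂ (∈-filter⁻ (λ (i , j) → f (toℕ i) ℕ.≤? toℕ j) {xs = allPairs n} p)

  roots-↭ : ∀ f (i j : Fin n) → f (toℕ i) ≡ toℕ j →
    roots f ↭ (i , j) ∷ roots (f [ toℕ i ≔ suc (toℕ j) ])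
  roots-↭ f i j fi≡j = ∼bag⇒↭ (unique∧set⇒bag (roots-unique f)
    (¬Any⇒All¬ _ fresh ∷ roots-unique f') (λ {β} → mk⇔ (to β) (from β)))
    where
    f' = f [ toℕ i ≔ suc (toℕ j) ]
    fresh : ¬ ((i , j) ∈ roots f')
    fresh p = ℕP.1+n≰n (≡.subst (_≤ toℕ j) (≔-same f (toℕ i) _) (∈-roots⁻ f' i j p))
    to : ∀ β → β ∈ roots f → β ∈ (i , j) ∷ roots f'
    to (a , b) p with toℕ a ℕ.≟ toℕ i
    ... | no a≢i = there (∈-roots⁺ f' a b (≡.subst (_≤ toℕ b) (≡.sym (≔-other f _ a≢i)) (∈-roots⁻ f a b p)))
    ... | yes a≡i with FinP.toℕ-injective a≡i | toℕ b ℕ.≟ toℕ j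
    ...   | ≡.refl | yes b≡j = here (≡.cong (i ,_) (FinP.toℕ-injective b≡j))
    ...   | ≡.refl | no b≢j = there (∈-roots⁺ f' i b (≡.subst (_≤ toℕ b) (≡.sym (≔-same f (toℕ a) _))
              (ℕP.≤∧≢⇒< (≡.subst (_≤ toℕ b) fi≡j (∈-roots⁻ f i b p)) (λ e → b≢j (≡.sym e)))))
    from : ∀ β → β ∈ (i , j) ∷ roots f' → β ∈ roots f
    from _ (here ≡.refl) = ∈-roots⁺ f i j (ℕP.≤-reflexive fi≡j)
    from (a , b) (there p) with toℕ a ℕ.≟ toℕ i
    ... | no a≢i = ∈-roots⁺ f a b (≡.subst (_≤ toℕ b) (≔-other f _ a≢i) (∈-roots⁻ f' a b p))
    ... | yes a≡i with FinP.toℕ-injective a≡i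
    ...   | ≡.refl = ∈-roots⁺ f i b (ℕP.≤-trans (ℕP.≤-reflexive fi≡j)
              (ℕP.<⇒≤ (≡.subst (_≤ toℕ b) (≔-same f (toℕ a) _) (∈-roots⁻ f' a b p))))

  -- Bounce paths

  Flat Step : Weight n → ℕ → Set
  Flat γ y = ∀ a b → toℕ a ≡ y → toℕ b ≡ suc y → γ a ≡ γ b
  Step γ y = ∀ a b → toℕ a ≡ y → toℕ b ≡ suc y → γ b ≡ γ a ℤ.+ + 1

  -- By `later` the path leaves rows y and y + 1 behind, so shifts at these rows do not disturb
  -- further nodes. By `only`, pushing row y + 1 on leaves no row beginning in column f y + 1, so
  -- that columns f y and f y + 1 come to agree.
  record Mirror (f : ℕ → ℕ) (y : ℕ) : Set where
    field
      later  : suc y < f y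
      next   : f (suc y) ≡ suc (f y)
      only   : ∀ r → f r ≡ suc (f y) → r ≡ suc y
      inside : suc (f y) < n

  -- The bounce path y, f y, f (f y), … down to a wall.
  data Chain (f : ℕ → ℕ) (γ : Weight n) (P : Weight n → ℕ → Set) (y : ℕ) : Set where
    wall   : suc y < n → f y ≡ f (suc y) → P γ y → Chain f γ P y
    mirror : Mirror f y → P γ y → Chain f γ Flat (f y) → Chain f γ P y

  head : ∀ {f γ P y} → Chain f γ P y → P γ y
  head (wall _ _ p)   = p
  head (mirror _ p _) = p

  -- A path looks at earlier rows only through `only`, that is in columns f y + 1 > y + 2;
  -- beginnings up to y + 2 are invisible to it. The bound is met with equality in `mirror-lemma₂`,
  -- where row y + 1 is pushed to column f y + 2 ahead of the path from f y.
  transport : ∀ {f f' γ γ'} {P P' : Weight n → ℕ → Set} {y} → Chain f γ P y →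
    (∀ r → f' r ≡ f r ⊎ (r < y × f' r ≤ suc (suc y))) →
    (∀ a → suc y < toℕ a → γ' a ≡ γ a) → P' γ' y → Chain f' γ' P' y
  transport {f} {f'} {y = y} (wall 1+y<n fy _) ef eγ p = wall 1+y<n (≡.trans (same y ℕP.≤-refl)
    (≡.trans fy (≡.sym (same (suc y) (ℕP.n≤1+n y))))) p
    where
    same : ∀ r → y ≤ r → f' r ≡ f r
    same r y≤r with ef r
    ... | inj₁ e = e
    ... | inj₂ (r<y , _) = contradiction y≤r (ℕP.<⇒≱ r<y)
  transport {f} {f'} {γ} {γ'} {P} {P'} {y} (mirror m _ c) ef eγ p =
    mirror m' p (≡.subst (Chain f' γ' Flat) (≡.sym f'y≡fy) (transport c ef' eγ' flat))
    where
    open Mirror m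
    same : ∀ r → y ≤ r → f' r ≡ f r
    same r y≤r with ef r
    ... | inj₁ e = e
    ... | inj₂ (r<y , _) = contradiction y≤r (ℕP.<⇒≱ r<y)
    f'y≡fy : f' y ≡ f y
    f'y≡fy = same y ℕP.≤-refl
    y<fy : y < f y
    y<fy = ℕP.<-trans ℕP.≤-refl later
    only' : ∀ r → f' r ≡ suc (f' y) → r ≡ suc y
    only' r e with ef r
    ... | inj₁ e' = only r (≡.trans (≡.sym e') (≡.trans e (≡.cong suc f'y≡fy)))
    ... | inj₂ (_ , f'r≤) = contradiction (ℕP.≤-trans (s≤s later) (ℕP.≤-reflexive (≡.sym (≡.trans e (≡.cong suc f'y≡fy)))))
                              (ℕP.≤⇒≯ f'r≤)
    m' : Mirror f' y
    m' = record
      { later  = ≡.subst (suc y <_) (≡.sym f'y≡fy) later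
      ; next   = ≡.trans (same (suc y) (ℕP.n≤1+n y)) (≡.trans next (≡.cong suc (≡.sym f'y≡fy)))
      ; only   = only'
      ; inside = ≡.subst (λ x → suc x < n) (≡.sym f'y≡fy) inside }
    ef' : ∀ r → f' r ≡ f r ⊎ (r < f y × f' r ≤ suc (suc (f y)))
    ef' r with ef r
    ... | inj₁ e = inj₁ e
    ... | inj₂ (r<y , le) = inj₂ (ℕP.<-trans r<y y<fy , ℕP.≤-trans le (s≤s (s≤s (ℕP.<⇒≤ y<fy))))
    eγ' : ∀ a → suc (f y) < toℕ a → γ' a ≡ γ a
    eγ' a q = eγ a (ℕP.<-trans (s≤s y<fy) q)
    flat : Flat γ' (f y)
    flat a b a≡ b≡ = ≡.trans (eγ a (≡.subst (suc y <_) (≡.sym a≡) later))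
      (≡.trans (head c a b a≡ b≡) (≡.sym (eγ b (≡.subst (suc y <_) (≡.sym b≡) (ℕP.<-trans later ℕP.≤-refl)))))

  move-left : ∀ (i j : Fin n) γ → i ≢ j → move (i , j) γ i ≡ γ i ℤ.+ + 1
  move-left i j γ i≢j rewrite unit-same i 1 | unit-other {i = j} 1 i≢j = ℤP.+-identityʳ _

  move-right : ∀ (i j : Fin n) γ → i ≢ j → move (i , j) γ j ≡ γ j ℤ.- + 1
  move-right i j γ i≢j rewrite unit-same j 1 | unit-other {i = i} {j} 1 (λ e → i≢j (≡.sym e)) =
    ≡.cong (ℤ._- + 1) (ℤP.+-identityʳ (γ j))

  move-other : ∀ (i j k : Fin n) γ → k ≢ i → k ≢ j → move (i , j) γ k ≡ γ k
  move-other i j k γ k≢i k≢j rewrite unit-other {i = i} 1 k≢i | unit-other {i = j} 1 k≢j =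
    ≡.trans (ℤP.+-identityʳ _) (ℤP.+-identityʳ _)

  toℕ-≢ : ∀ {a b : Fin n} → toℕ a ≢ toℕ b → a ≢ b
  toℕ-≢ p e = p (≡.cong toℕ e)

module MirrorLemma {c ℓ : Level} (R : CommutativeRing c ℓ) (h : ℕ → CommutativeRing.Carrier R) (n : ℕ) where
  open CommutativeRing R hiding (zero)
  open SymFun R h
  open Operators R h n

  coeffH-remove : ∀ f (i j : Fin n) → f (toℕ i) ≡ toℕ j → ∀ d γ →
    coeffH (roots f) d γ ≈ coeffH (roots (f [ toℕ i ≔ suc (toℕ j) ])) d γ
      + delay (λ e → coeffH (roots f) e (move (i , j) γ)) d
  coeffH-remove f i j fi≡j d γ = trans (coeffH-↭ p d γ)
    (trans (coeffH-∷ (i , j) (roots (f [ toℕ i ≔ suc (toℕ j) ])) d γ) (+-congˡ (delay-↭ d)))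
    where
    p = roots-↭ f i j fi≡j
    delay-↭ : ∀ d → delay (λ e → coeffH ((i , j) ∷ roots (f [ toℕ i ≔ suc (toℕ j) ])) e (move (i , j) γ)) d
                  ≈ delay (λ e → coeffH (roots f) e (move (i , j) γ)) d
    delay-↭ zero    = refl
    delay-↭ (suc d) = sym (coeffH-↭ p d (move (i , j) γ))

  -- Columns y and y + 1 can differ only in a row that begins in column y + 1. Without such a row,
  -- and with rows y and y + 1 beginning together, the root set is closed under σ.
  toggle-roots : ∀ f y → suc y < n → f y ≡ f (suc y) → (∀ r → f r ≢ suc y) →
    ∀ γ → Step γ y → ∀ d → coeffH (roots f) d γ ≈ 0#
  toggle-roots f y 1+y<n fy ceiling γ step d = toggle (roots f) (roots-unique f)
    (λ {β} → closed {β}) d γ (reflect reflected)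
    where
    a b : Fin n
    a = fromℕ< (ℕP.<-trans ℕP.≤-refl 1+y<n)
    b = fromℕ< 1+y<n
    a≡ : toℕ a ≡ y
    a≡ = FinP.toℕ-fromℕ< _
    b≡ : toℕ b ≡ suc y
    b≡ = FinP.toℕ-fromℕ< _
    open Toggle a b (≡.trans b≡ (≡.cong suc (≡.sym a≡)))
    fσ : ∀ i → f (toℕ (σ i)) ≡ f (toℕ i)
    fσ = transpose-elim a b (λ i j → f (toℕ j) ≡ f (toℕ i))
      (≡.trans (≡.cong f b≡) (≡.trans (≡.sym fy) (≡.cong f (≡.sym a≡))))
      (≡.trans (≡.cong f a≡) (≡.trans fy (≡.cong f (≡.sym b≡)))) (λ _ _ _ → ≡.refl)
    column : ∀ r j → f r ≤ toℕ j → f r ≤ toℕ (σ j)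
    column r = transpose-elim a b (λ i j → f r ≤ toℕ i → f r ≤ toℕ j)
      (λ p → ≡.subst (f r ≤_) (≡.sym b≡) (ℕP.m≤n⇒m≤1+n (≡.subst (f r ≤_) a≡ p)))
      (λ p → ≡.subst (f r ≤_) (≡.sym a≡) (ℕP.≤-pred (ℕP.≤∧≢⇒< (≡.subst (f r ≤_) b≡ p) (ceiling r))))
      (λ _ _ _ p → p)
    closed : Closed (roots f)
    closed {i , j} p = ∈-roots⁺ f (σ i) (σ j)
      (≡.subst (_≤ toℕ (σ j)) (≡.sym (fσ i)) (column (toℕ i) j (∈-roots⁻ f i j p)))
    γb : γ b ≡ γ a ℤ.+ + 1
    γb = step a b a≡ b≡
    up : ∀ x z → x ℤ.- z ≡ x ℤ.+ + 1 ℤ.- (+ 1 ℤ.+ z)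
    up = solve-∀
    γa-a≡γb-b : γ a ℤ.- + toℕ a ≡ γ b ℤ.- + toℕ b
    γa-a≡γb-b rewrite γb | b≡ | a≡ = up (γ a) (+ y)
    reflected : ∀ m → γ m ℤ.- + toℕ m ≡ γ (σ m) ℤ.- + toℕ (σ m)
    reflected = transpose-elim a b (λ i j → γ i ℤ.- + toℕ i ≡ γ j ℤ.- + toℕ j)
      γa-a≡γb-b (≡.sym γa-a≡γb-b) (λ _ _ _ → ≡.refl)

  -- Moving the defect between the first two nodes of the path costs a factor of t each
  -- time, so the induction is on the degree in t.
  mirror-lemma : ∀ d {f γ y} → Chain f γ Step y → (∀ r → f r ≢ suc y) → coeffH (roots f) d γ ≈ 0#
  mirror-lemma₂ : ∀ d {f γ y} → suc y < n → Mirror f y → Flat γ y → Chain f γ Step (f y) →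
    (∀ r → f r ≢ suc y) → coeffH (roots f) d γ ≈ 0#

  mirror-lemma d {f} {γ} {y} (wall 1+y<n fy step) ceiling = toggle-roots f y 1+y<n fy ceiling γ step d
  mirror-lemma d {f} {γ} {y} (mirror m step c) ceiling =
    -- Without the root (y , f y) rows y and y + 1 begin together, and `toggle-roots` applies. The
    -- other term, of lower degree, has its defect moved from y to f y.
    trans (coeffH-remove f a a' fa≡a' d γ)
      (trans (+-cong (toggle-roots f' y 1+y<n f'y ceiling' γ step d) (rest d)) (+-identityˡ 0#))
    where
    open Mirror m
    y<fy : y < f y
    y<fy = ℕP.<-trans ℕP.≤-refl later
    1+y<n : suc y < n
    1+y<n = ℕP.<-trans later (ℕP.<-trans ℕP.≤-refl inside)
    a a' : Fin n
    a  = fromℕ< (ℕP.<-trans ℕP.≤-refl 1+y<n)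
    a' = fromℕ< (ℕP.<-trans ℕP.≤-refl inside)
    a≡ : toℕ a ≡ y
    a≡ = FinP.toℕ-fromℕ< _
    a'≡ : toℕ a' ≡ f y
    a'≡ = FinP.toℕ-fromℕ< _
    a≢a' : a ≢ a'
    a≢a' e = ℕP.<⇒≢ y<fy (≡.trans (≡.sym a≡) (≡.trans (≡.cong toℕ e) a'≡))
    fa≡a' : f (toℕ a) ≡ toℕ a'
    fa≡a' = ≡.trans (≡.cong f a≡) (≡.sym a'≡)
    f' = f [ toℕ a ≔ suc (toℕ a') ]
    f'-y : f' y ≡ suc (f y)
    f'-y = ≡.trans (≡.cong f' (≡.sym a≡)) (≡.trans (≔-same f (toℕ a) _) (≡.cong suc a'≡))
    f'y : f' y ≡ f' (suc y)
    f'y = ≡.trans f'-y (≡.trans (≡.sym next)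
      (≡.sym (≔-other f _ (λ e → ℕP.1+n≢n (≡.trans e a≡)))))
    ceiling' : ∀ r → f' r ≢ suc y
    ceiling' r with r ℕ.≟ toℕ a
    ... | yes _ = λ e → ℕP.<⇒≢ y<fy (≡.sym (≡.trans (≡.sym a'≡) (ℕP.suc-injective e)))
    ... | no  _ = ceiling r
    γ' = move (a , a') γ
    flat : Flat γ' y
    flat b b' b≡ b'≡ with FinP.toℕ-injective (≡.trans b≡ (≡.sym a≡))
    ... | ≡.refl = ≡.trans (move-left a a' γ a≢a') (≡.trans (≡.sym (step a b' b≡ b'≡))
      (≡.sym (move-other a a' b' γ
        (toℕ-≢ (λ e → ℕP.1+n≢n (≡.trans (≡.sym b'≡) (≡.trans e a≡))))
        (toℕ-≢ (λ e → ℕP.<⇒≢ later (≡.trans (≡.sym b'≡) (≡.trans e a'≡)))))))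
    step' : Step γ' (f y)
    step' b b' b≡ b'≡ with FinP.toℕ-injective (≡.trans b≡ (≡.sym a'≡))
    ... | ≡.refl = ≡.trans (move-other a a' b' γ
        (toℕ-≢ (λ e → ℕP.<⇒≢ (ℕP.<-trans y<fy ℕP.≤-refl) (≡.trans (≡.sym a≡) (≡.trans (≡.sym e) b'≡))))
        (toℕ-≢ (λ e → ℕP.1+n≢n (≡.trans (≡.sym b'≡) (≡.trans e a'≡)))))
      (≡.trans (≡.sym (head c a' b' b≡ b'≡)) (≡.trans (cancel (γ a'))
        (≡.cong (ℤ._+ + 1) (≡.sym (move-right a a' γ a≢a')))))
      where
      cancel : ∀ x → x ≡ x ℤ.- + 1 ℤ.+ + 1
      cancel = solve-∀
    unmoved : ∀ b → suc (f y) < toℕ b → γ' b ≡ γ b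
    unmoved b q = move-other a a' b γ
      (toℕ-≢ (λ e → ℕP.<⇒≢ (ℕP.<-trans y<fy (ℕP.<-trans ℕP.≤-refl q)) (≡.trans (≡.sym a≡) (≡.sym e))))
      (toℕ-≢ (λ e → ℕP.<⇒≢ (ℕP.<-trans ℕP.≤-refl q) (≡.trans (≡.sym a'≡) (≡.sym e))))
    rest : ∀ d → delay (λ e → coeffH (roots f) e γ') d ≈ 0#
    rest zero    = refl
    rest (suc e) = mirror-lemma₂ e 1+y<n m flat (transport c (λ _ → inj₁ ≡.refl) unmoved step') ceiling

  mirror-lemma₂ d {f} {γ} {y} 1+y<n m flat c ceiling =
    -- Without the root (y + 1 , f y + 1) no row begins in column f y + 1, and the shorter path from
    -- f y serves in the same degree. The other term, of lower degree, has its defect moved back to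
    -- y.
    trans (coeffH-remove f a a' fa≡a' d γ)
      (trans (+-cong (mirror-lemma d (transport c changed (λ _ _ → ≡.refl) (head c)) ceiling') (rest d))
        (+-identityˡ 0#))
    where
    open Mirror m
    y<fy : y < f y
    y<fy = ℕP.<-trans ℕP.≤-refl later
    a a' : Fin n
    a  = fromℕ< 1+y<n
    a' = fromℕ< inside
    a≡ : toℕ a ≡ suc y
    a≡ = FinP.toℕ-fromℕ< _
    a'≡ : toℕ a' ≡ suc (f y)
    a'≡ = FinP.toℕ-fromℕ< _
    a≢a' : a ≢ a'
    a≢a' e = ℕP.<⇒≢ (s≤s y<fy) (≡.trans (≡.sym a≡) (≡.trans (≡.cong toℕ e) a'≡))
    fa≡a' : f (toℕ a) ≡ toℕ a'
    fa≡a' = ≡.trans (≡.cong f a≡) (≡.trans next (≡.sym a'≡))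
    f' = f [ toℕ a ≔ suc (toℕ a') ]
    changed : ∀ r → f' r ≡ f r ⊎ (r < f y × f' r ≤ suc (suc (f y)))
    changed r with r ℕ.≟ toℕ a
    ... | yes r≡a = inj₂ (≡.subst (_< f y) (≡.sym (≡.trans r≡a a≡)) later , ℕP.≤-reflexive (≡.cong suc a'≡))
    ... | no  _   = inj₁ ≡.refl
    ceiling' : ∀ r → f' r ≢ suc (f y)
    ceiling' r with r ℕ.≟ toℕ a
    ... | yes _  = λ e → ℕP.1+n≢n (≡.trans (≡.cong suc (≡.sym a'≡)) e)
    ... | no r≢a = λ e → r≢a (≡.trans (only r e) (≡.sym a≡))
    γ' = move (a , a') γ
    step : Step γ' y
    step b b' b≡ b'≡ with FinP.toℕ-injective (≡.trans b'≡ (≡.sym a≡))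
    ... | ≡.refl = ≡.trans (move-left a a' γ a≢a') (≡.cong (ℤ._+ + 1)
      (≡.trans (≡.sym (flat b a b≡ b'≡)) (≡.sym (move-other a a' b γ
        (toℕ-≢ (λ e → ℕP.1+n≢n (≡.trans (≡.sym a≡) (≡.trans (≡.sym e) b≡))))
        (toℕ-≢ (λ e → ℕP.<⇒≢ (ℕP.<-trans y<fy ℕP.≤-refl) (≡.trans (≡.sym b≡) (≡.trans e a'≡))))))))
    flat' : Flat γ' (f y)
    flat' b b' b≡ b'≡ with FinP.toℕ-injective (≡.trans b'≡ (≡.sym a'≡))
    ... | ≡.refl = ≡.trans (move-other a a' b γ
        (toℕ-≢ (λ e → ℕP.<⇒≢ later (≡.trans (≡.sym a≡) (≡.trans (≡.sym e) b≡))))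
        (toℕ-≢ (λ e → ℕP.1+n≢n (≡.trans (≡.sym a'≡) (≡.trans (≡.sym e) b≡)))))
      (≡.trans (cancel (γ b)) (≡.trans (≡.cong (ℤ._- + 1) (≡.sym (head c b a' b≡ b'≡)))
        (≡.sym (move-right a a' γ a≢a'))))
      where
      cancel : ∀ x → x ≡ x ℤ.+ + 1 ℤ.- + 1
      cancel = solve-∀
    unmoved : ∀ b → suc (f y) < toℕ b → γ' b ≡ γ b
    unmoved b q = move-other a a' b γ
      (toℕ-≢ (λ e → ℕP.<⇒≢ (ℕP.<-trans (s≤s y<fy) q) (≡.trans (≡.sym a≡) (≡.sym e))))
      (toℕ-≢ (λ e → ℕP.<⇒≢ q (≡.trans (≡.sym a'≡) (≡.sym e))))
    rest : ∀ d → delay (λ e → coeffH (roots f) e γ') d ≈ 0#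
    rest zero    = refl
    rest (suc e) = mirror-lemma e (mirror m step (transport c (λ _ → inj₁ ≡.refl) unmoved flat')) ceiling

-- Row r is to be pushed from D r to P r; E j stands for κ_j = κ_{j+1}, j + 1 < n.
record Interpolation (n : ℕ) (γ : Weight n) (D P : ℕ → ℕ) : Set₁ where
  field
    E      : ℕ → Set
    D-mono : ∀ {r s} → r < s → D r < n → D r < D s
    P-mono : ∀ {r s} → r < s → P r < n → P r < P s
    D≤P    : ∀ r → D r ≤ P r
    P<n    : ∀ r → D r < n → P r < n
    r<D    : ∀ r → r < n → r < D r
    E-gap  : ∀ {r j} → D r ≤ j → j < P r → E j
    E<n    : ∀ {j} → E j → suc j < n
    E-flat : ∀ {j} → E j → Flat γ j
    E-late : ∀ {j} → E j → suc j < P j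
    E-next : ∀ {j} → E j → P j ≡ P (suc j) ⊎ (P (suc j) ≡ suc (P j) × E (P j))

module _ {c ℓ : Level} (R : CommutativeRing c ℓ) (h : ℕ → CommutativeRing.Carrier R)
  {n : ℕ} {γ : Weight n} {D P : ℕ → ℕ} (I : Interpolation n γ D P) where
  open CommutativeRing R hiding (zero)
  open SymFun R h
  open Operators R h n
  open MirrorLemma R h n
  open Interpolation I

  stage : ℕ → ℕ → ℕ
  stage m r with r ℕ.<? m
  ... | yes _ = D r
  ... | no  _ = P r

  module _ {i j : ℕ} (i<n : i < n) (Di≤j : D i ≤ j) (j<Pi : j < P i) where
    private
      f : ℕ → ℕ
      f = stage i [ i ≔ j ]

      f-cases : ∀ r → (r < i × f r ≡ D r) ⊎ ((r ≡ i × f r ≡ j) ⊎ (i < r × f r ≡ P r))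
      f-cases r with r ℕ.≟ i
      ... | yes r≡i = inj₂ (inj₁ (r≡i , ≡.refl))
      ... | no r≢i with r ℕ.<? i
      ...   | yes r<i = inj₁ (r<i , ≡.refl)
      ...   | no r≮i  = inj₂ (inj₂ (ℕP.≤∧≢⇒< (ℕP.≮⇒≥ r≮i) (λ e → r≢i (≡.sym e)) , ≡.refl))

      f-above : ∀ {r} → i < r → f r ≡ P r
      f-above {r} i<r with f-cases r
      ... | inj₁ (r<i , _)           = contradiction r<i (ℕP.<-asym i<r)
      ... | inj₂ (inj₁ (≡.refl , _)) = contradiction i<r (ℕP.<-irrefl ≡.refl)
      ... | inj₂ (inj₂ (_ , e))      = e

      Ej : E j
      Ej = E-gap Di≤j j<Pi

      1+j<n : suc j < n
      1+j<n = E<n Ej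

      j<n : j < n
      j<n = ℕP.<-trans ℕP.≤-refl 1+j<n

      i<j : i < j
      i<j = ℕP.≤-trans (r<D i i<n) Di≤j

      D<Di : ∀ {r} → r < i → D r < n → D r ≤ j
      D<Di r<i Dr<n = ℕP.<⇒≤ (ℕP.<-≤-trans (D-mono r<i Dr<n) Di≤j)

      -- Rows before i begin before D i ≤ j, unless they are empty; rows after i begin beyond P i,
      -- which is at least j + 1.
      ceiling : ∀ r → f r ≢ suc j
      ceiling r e with f-cases r
      ... | inj₁ (r<i , e') = contradiction (D<Di r<i (≡.subst (_< n) (≡.sym Dr≡) 1+j<n))
                                (ℕP.<⇒≱ (ℕP.≤-reflexive (≡.sym Dr≡)))
        where
        Dr≡ : D r ≡ suc j
        Dr≡ = ≡.trans (≡.sym e') e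
      ... | inj₂ (inj₁ (_ , e')) = ℕP.1+n≢n (≡.trans (≡.sym e) e')
      ... | inj₂ (inj₂ (i<r , e')) = contradiction (≡.subst (P i <_) (≡.trans (≡.sym e') e) (P-mono i<r (P<n i (ℕP.≤-<-trans Di≤j j<n))))
                                       (ℕP.≤⇒≯ j<Pi)

      -- Since y < P y, every mirror brings the path closer to n; `N` bounds the distance left.
      chain : ∀ N {y} → n ≤ y ℕ.+ N → j ≤ y → E y → Chain f γ Flat y
      chain zero {y} n≤y _ Ey = contradiction (ℕP.<-trans ℕP.≤-refl (E<n Ey))
        (ℕP.≤⇒≯ (≡.subst (n ≤_) (ℕP.+-identityʳ y) n≤y))
      chain (suc N) {y} n≤ j≤y Ey with E-next Ey
      ... | inj₁ e = wall (E<n Ey) (≡.trans (f-above i<y) (≡.trans e (≡.sym (f-above (ℕP.m<n⇒m<1+n i<y))))) (E-flat Ey)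
        where
        i<y : i < y
        i<y = ℕP.<-≤-trans i<j j≤y
      ... | inj₂ (e , EP) = mirror m (E-flat Ey) (≡.subst (Chain f γ Flat) (≡.sym fy≡)
              (chain N n≤' (ℕP.≤-trans j≤y (ℕP.<⇒≤ y<Py)) EP))
        where
        i<y : i < y
        i<y = ℕP.<-≤-trans i<j j≤y
        y<Py : y < P y
        y<Py = ℕP.<-trans ℕP.≤-refl (E-late Ey)
        fy≡ : f y ≡ P y
        fy≡ = f-above i<y
        n≤' : n ≤ P y ℕ.+ N
        n≤' = ℕP.≤-trans n≤ (ℕP.≤-trans (ℕP.≤-reflexive (ℕP.+-suc y N)) (ℕP.+-monoˡ-≤ N y<Py))
        only : ∀ r → f r ≡ suc (P y) → r ≡ suc y
        only r e' with f-cases r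
        ... | inj₁ (r<i , e'') = contradiction
                (ℕP.≤-trans (ℕP.≤-reflexive (≡.sym Dr≡)) (ℕP.≤-trans (D<Di r<i (≡.subst (_< n) (≡.sym Dr≡) (E<n EP))) j≤y))
                (ℕP.<⇒≱ (ℕP.<-trans y<Py ℕP.≤-refl))
          where
          Dr≡ : D r ≡ suc (P y)
          Dr≡ = ≡.trans (≡.sym e'') e'
        ... | inj₂ (inj₁ (_ , e'')) = contradiction (≡.subst (_≤ y) (≡.trans (≡.sym e'') e') j≤y)
                                        (ℕP.<⇒≱ (ℕP.<-trans y<Py ℕP.≤-refl))
        ... | inj₂ (inj₂ (_ , e'')) with ℕP.<-cmp r (suc y)
        ...   | tri≈ _ r≡ _ = r≡
        ...   | tri< r< _ _ = contradiction (≡.trans Pr≡ (≡.sym e)) (ℕP.<⇒≢ (P-mono r< (≡.subst (_< n) (≡.sym Pr≡) (E<n EP))))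
          where
          Pr≡ : P r ≡ suc (P y)
          Pr≡ = ≡.trans (≡.sym e'') e'
        ...   | tri> _ _ r> = contradiction (≡.trans e (≡.trans (≡.sym e') e'')) (ℕP.<⇒≢ (P-mono r> (≡.subst (_< n) (≡.sym e) (E<n EP))))
        m : Mirror f y
        m = record
          { later  = ≡.subst (suc y <_) (≡.sym fy≡) (E-late Ey)
          ; next   = ≡.trans (f-above (ℕP.m<n⇒m<1+n i<y)) (≡.trans e (≡.cong suc (≡.sym fy≡)))
          ; only   = λ r e' → only r (≡.trans e' (≡.cong suc fy≡))
          ; inside = ≡.subst (λ x → suc x < n) (≡.sym fy≡) (E<n EP) }

      a b : Fin n
      a = fromℕ< i<n
      b = fromℕ< j<n
      a≡ : toℕ a ≡ i
      a≡ = FinP.toℕ-fromℕ< i<n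
      b≡ : toℕ b ≡ j
      b≡ = FinP.toℕ-fromℕ< j<n
      a≢b : a ≢ b
      a≢b e = ℕP.<⇒≢ i<j (≡.trans (≡.sym a≡) (≡.trans (≡.cong toℕ e) b≡))

      chain' : Chain f (move (a , b) γ) Step j
      chain' = transport (chain n (ℕP.m≤n+m n j) ℕP.≤-refl Ej) (λ _ → inj₁ ≡.refl)
        (λ x q → move-other a b x γ
          (toℕ-≢ (λ e → ℕP.<⇒≢ (ℕP.<-trans i<j (ℕP.<-trans ℕP.≤-refl q)) (≡.trans (≡.sym a≡) (≡.sym e))))
          (toℕ-≢ (λ e → ℕP.<⇒≢ (ℕP.<-trans ℕP.≤-refl q) (≡.trans (≡.sym b≡) (≡.sym e)))))
        step
        where
        step : Step (move (a , b) γ) j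
        step x z x≡ z≡ with FinP.toℕ-injective (≡.trans x≡ (≡.sym b≡))
        ... | ≡.refl = ≡.trans (move-other a b z γ
            (toℕ-≢ (λ e → ℕP.<⇒≢ (ℕP.<-trans i<j ℕP.≤-refl) (≡.trans (≡.sym a≡) (≡.trans (≡.sym e) z≡))))
            (toℕ-≢ (λ e → ℕP.1+n≢n (≡.trans (≡.sym z≡) (≡.trans e b≡)))))
          (≡.trans (≡.sym (E-flat Ej b z x≡ z≡)) (≡.trans (cancel (γ b))
            (≡.cong (ℤ._+ + 1) (≡.sym (move-right a b γ a≢b)))))
          where
          cancel : ∀ x → x ≡ x ℤ.- + 1 ℤ.+ + 1
          cancel = solve-∀

    coeffH-start-suc : ∀ d → coeffH (roots (stage i [ i ≔ j ])) d γ ≈ coeffH (roots (stage i [ i ≔ suc j ])) d γ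
    coeffH-start-suc d = trans (coeffH-remove f a b fa≡b d γ)
      (trans (+-cong (reflexive (≡.cong (λ Ψ → coeffH Ψ d γ) (roots-cong same))) (rest d)) (+-identityʳ _))
      where
      fa≡b : f (toℕ a) ≡ toℕ b
      fa≡b = ≡.trans (≡.cong f a≡) (≡.trans (≔-same (stage i) i j) (≡.sym b≡))
      same : ∀ r → r < n → (f [ toℕ a ≔ suc (toℕ b) ]) r ≡ (stage i [ i ≔ suc j ]) r
      same r _ rewrite a≡ | b≡ with r ℕ.≟ i
      ... | yes _  = ≡.refl
      ... | no r≢i = ≔-other (stage i) j r≢i
      rest : ∀ d → delay (λ e → coeffH (roots f) e (move (a , b) γ)) d ≈ 0#
      rest zero    = refl
      rest (suc e) = mirror-lemma e chain' ceiling

  coeffH-start : ∀ {i} → i < n → ∀ d m j → D i ≤ j → j ℕ.+ m ≡ P i →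
    coeffH (roots (stage i [ i ≔ j ])) d γ ≈ coeffH (roots (stage i [ i ≔ P i ])) d γ
  coeffH-start {i} i<n d zero    j Di≤j e =
    reflexive (≡.cong (λ x → coeffH (roots (stage i [ i ≔ x ])) d γ) (≡.trans (≡.sym (ℕP.+-identityʳ j)) e))
  coeffH-start {i} i<n d (suc m) j Di≤j e = trans
    (coeffH-start-suc i<n Di≤j (≡.subst (j <_) e (ℕP.m<m+n j (s≤s z≤n))) d)
    (coeffH-start i<n d m (suc j) (ℕP.m≤n⇒m≤1+n Di≤j) (≡.trans (≡.sym (ℕP.+-suc j m)) e))

  stage-suc : ∀ i r → stage (suc i) r ≡ (stage i [ i ≔ D i ]) r
  stage-suc i r with r ℕ.≟ i
  stage-suc i r | yes ≡.refl with r ℕ.<? suc r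
  ... | yes _ = ≡.refl
  ... | no ¬p = contradiction ℕP.≤-refl ¬p
  stage-suc i r | no r≢i with r ℕ.<? suc i | r ℕ.<? i
  ... | yes _ | yes _ = ≡.refl
  ... | no _  | no _  = ≡.refl
  ... | yes p | no ¬q = contradiction (ℕP.≤∧≢⇒< (ℕP.≤-pred p) r≢i) ¬q
  ... | no ¬p | yes q = contradiction (ℕP.m<n⇒m<1+n q) ¬p

  stage-P : ∀ i r → (stage i [ i ≔ P i ]) r ≡ stage i r
  stage-P i r with r ℕ.≟ i
  ... | no _ = ≡.refl
  ... | yes ≡.refl with r ℕ.<? r
  ...   | yes p = contradiction p (ℕP.<-irrefl ≡.refl)
  ...   | no _ = ≡.refl

  coeffH-roots-cong : ∀ {f g} → (∀ r → r < n → f r ≡ g r) → ∀ d → coeffH (roots f) d γ ≈ coeffH (roots g) d γ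
  coeffH-roots-cong e d = reflexive (≡.cong (λ Ψ → coeffH Ψ d γ) (roots-cong e))

  coeffH-stage : ∀ m → m ≤ n → ∀ d → coeffH (roots (stage m)) d γ ≈ coeffH (roots (stage 0)) d γ
  coeffH-stage zero    _   d = refl
  coeffH-stage (suc m) m<n d = trans (coeffH-roots-cong (λ r _ → stage-suc m r) d)
    (trans (coeffH-start m<n d (P m ∸ D m) (D m) ℕP.≤-refl (ℕP.m+[n∸m]≡n (D≤P m)))
    (trans (coeffH-roots-cong (λ r _ → stage-P m r) d) (coeffH-stage m (ℕP.<⇒≤ m<n) d)))

  coeffH-interpolate : ∀ d → coeffH (roots D) d γ ≈ coeffH (roots P) d γ
  coeffH-interpolate d = trans (coeffH-roots-cong below d) (coeffH-stage n ℕP.≤-refl d)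
    where
    below : ∀ r → r < n → D r ≡ stage n r
    below r r<n with r ℕ.<? n
    ... | yes _ = ≡.refl
    ... | no r≮n = contradiction r<n r≮n

-- Cores

open import Data.Nat using (_+_; _⊓_)

module _ {P : ℕ → Set} (P? : ∀ c → Dec (P c)) where

  count-∷ʳ : ∀ n → count P? (upTo (suc n)) ≡ count P? (upTo n) + count P? (n ∷ [])
  count-∷ʳ n = ≡.trans (≡.cong (count P?) (≡.sym (upTo-∷ʳ n)))
    (≡.trans (≡.cong length (filter-++ P? (upTo n) (n ∷ []))) (length-++ (filter P? (upTo n))))

  -- `pPart`, `lenEta` and `mu` are defined by counting. Monotonicity makes each counted set an
  -- interval, and this turns the counts into differences.
  count-interval : ∀ a b n → (∀ c → c < n → P c → a ≤ c × c < b) → (∀ c → c < n → a ≤ c → c < b → P c) →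
    count P? (upTo n) ≡ b ⊓ n ∸ a
  count-interval a b zero    _  _    = ≡.sym (≡.trans (≡.cong (_∸ a) (ℕP.⊓-zeroʳ b)) (ℕP.0∸n≡0 a))
  count-interval a b (suc n) to from rewrite count-∷ʳ n
    | count-interval a b n (λ c c<n → to c (ℕP.m<n⇒m<1+n c<n)) (λ c c<n → from c (ℕP.m<n⇒m<1+n c<n)) with P? n
  ... | yes p = begin
          b ⊓ n ∸ a + 1    ≡⟨ ≡.cong (λ x → x ∸ a + 1) (ℕP.m≥n⇒m⊓n≡n (ℕP.<⇒≤ n<b)) ⟩
          n ∸ a + 1        ≡⟨ ℕP.+-comm (n ∸ a) 1 ⟩
          1 + (n ∸ a)      ≡⟨ ℕP.+-∸-assoc 1 a≤n ⟨
          suc n ∸ a        ≡⟨ ≡.cong (_∸ a) (ℕP.m≥n⇒m⊓n≡n n<b) ⟨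
          b ⊓ suc n ∸ a    ∎
    where
    open ≡.≡-Reasoning
    a≤n : a ≤ n
    a≤n = proj₁ (to n ℕP.≤-refl p)
    n<b : n < b
    n<b = proj₂ (to n ℕP.≤-refl p)
  ... | no ¬p with a ℕ.≤? n | b ℕ.≤? n
  ...   | yes a≤n | no b≰n  = contradiction (from n ℕP.≤-refl a≤n (ℕP.≰⇒> b≰n)) ¬p
  ...   | no a≰n  | _       = ≡.trans (ℕP.+-identityʳ _) (≡.trans
            (ℕP.m≤n⇒m∸n≡0 (ℕP.≤-trans (ℕP.m⊓n≤n b n) (ℕP.<⇒≤ (ℕP.≰⇒> a≰n))))
            (≡.sym (ℕP.m≤n⇒m∸n≡0 (ℕP.≤-trans (ℕP.m⊓n≤n b (suc n)) (ℕP.≰⇒> a≰n)))))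
  ...   | yes _   | yes b≤n = ≡.trans (ℕP.+-identityʳ _) (≡.cong (_∸ a)
            (≡.trans (ℕP.m≤n⇒m⊓n≡m b≤n) (≡.sym (ℕP.m≤n⇒m⊓n≡m (ℕP.m≤n⇒m≤1+n b≤n)))))

  threshold : ∀ n → (∀ {c d} → c ≤ d → d < n → P c → P d) →
    ∃ λ m → m ≤ n × (∀ c → c < n → P c → m ≤ c) × (∀ c → c < n → m ≤ c → P c)
  threshold zero    up = 0 , z≤n , (λ _ ()) , (λ _ ())
  threshold (suc n) up with P? n
  ... | no ¬p = suc n , ℕP.≤-refl , (λ c c<1+n pc → contradiction (up (ℕP.≤-pred c<1+n) ℕP.≤-refl pc) ¬p)
                    , (λ c c<1+n n<c → contradiction c<1+n (ℕP.≤⇒≯ n<c))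
  ... | yes p with threshold n (λ c≤d d<n → up c≤d (ℕP.m<n⇒m<1+n d<n))
  ...   | m , m≤n , to , from = m , ℕP.m≤n⇒m≤1+n m≤n , to' , from'
    where
    to' : ∀ c → c < suc n → P c → m ≤ c
    to' c c<1+n pc with ℕP.m≤n⇒m<n∨m≡n (ℕP.≤-pred c<1+n)
    ... | inj₁ c<n    = to c c<n pc
    ... | inj₂ ≡.refl = m≤n
    from' : ∀ c → c < suc n → m ≤ c → P c
    from' c c<1+n m≤c with ℕP.m≤n⇒m<n∨m≡n (ℕP.≤-pred c<1+n)
    ... | inj₁ c<n    = from c c<n m≤c
    ... | inj₂ ≡.refl = p

Decreasing : List ℕ → Set
Decreasing xs = ∀ r → nth xs (suc r) ≤ nth xs r

nth-antitone : ∀ xs → Decreasing xs → ∀ {r s} → r ≤ s → nth xs s ≤ nth xs r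
nth-antitone xs dec {s = s} r≤s with ℕP.m≤n⇒∃[o]m+o≡n r≤s
... | o , ≡.refl = go o
  where
  go : ∀ {r} o → nth xs (r + o) ≤ nth xs r
  go {r} zero    rewrite ℕP.+-identityʳ r = ℕP.≤-refl
  go {r} (suc o) rewrite ℕP.+-suc r o = ℕP.≤-trans (dec (r + o)) (go o)

nth-≤ : ∀ {k xs} → All (_≤ k) xs → ∀ r → nth xs r ≤ k
nth-≤ []       _       = z≤n
nth-≤ (p ∷ ps) zero    = p
nth-≤ (p ∷ ps) (suc r) = nth-≤ ps r

nth-positive : ∀ {xs} → All (0 <_) xs → ∀ {r} → r < length xs → 0 < nth xs r
nth-positive (p ∷ ps) {zero}  _       = p
nth-positive (p ∷ ps) {suc r} (s≤s q) = nth-positive ps q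

nth-<length : ∀ xs {r} → 0 < nth xs r → r < length xs
nth-<length (x ∷ xs) {zero}  _ = s≤s z≤n
nth-<length (x ∷ xs) {suc r} p = s≤s (nth-<length xs p)

colLen-≤ : ∀ κ c → colLen κ c ≤ length κ
colLen-≤ κ c = length-filter (c ℕ.<?_) κ

colLen-accept : ∀ {x} κ {c} → c < x → colLen (x ∷ κ) c ≡ suc (colLen κ c)
colLen-accept κ {c} c<x = ≡.cong length (filter-accept (c ℕ.<?_) {xs = κ} c<x)

colLen-reject : ∀ {x} κ {c} → ¬ (c < x) → colLen (x ∷ κ) c ≡ colLen κ c
colLen-reject κ {c} c≮x = ≡.cong length (filter-reject (c ℕ.<?_) {xs = κ} c≮x)

colLen-⁻ : ∀ κ c → Decreasing κ → ∀ r → r < colLen κ c → c < nth κ r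
colLen-⁻ (x ∷ κ) c dec r r<len with c ℕ.<? x
colLen-⁻ (x ∷ κ) c dec zero    _     | yes c<x = c<x
colLen-⁻ (x ∷ κ) c dec (suc r) r<len | yes c<x =
  colLen-⁻ κ c (λ r → dec (suc r)) r (ℕP.≤-pred (≡.subst (suc (suc r) ≤_) (colLen-accept κ c<x) r<len))
colLen-⁻ (x ∷ κ) c dec r       r<len | no c≮x  =
  contradiction (ℕP.<-≤-trans (colLen-⁻ κ c (λ r → dec (suc r)) r (≡.subst (r <_) (colLen-reject κ c≮x) r<len))
                              (nth-antitone (x ∷ κ) dec {0} {suc r} z≤n)) c≮x

colLen-⁺ : ∀ κ c → Decreasing κ → ∀ r → c < nth κ r → r < colLen κ c
colLen-⁺ (x ∷ κ) c dec r c<κr = ≡.subst (r <_) (≡.sym (colLen-accept κ c<x)) (go r c<κr)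
  where
  c<x : c < x
  c<x = ℕP.<-≤-trans c<κr (nth-antitone (x ∷ κ) dec {0} {r} z≤n)
  go : ∀ r → c < nth (x ∷ κ) r → r < suc (colLen κ c)
  go zero    _ = s≤s z≤n
  go (suc r) p = s≤s (colLen-⁺ κ c (λ r → dec (suc r)) r p)

hook-antitone : ∀ κ → Decreasing κ → ∀ r {c d} → c ≤ d → hook κ r d ≤ hook κ r c
hook-antitone κ dec r {c} {d} c≤d = ℕP.+-mono-≤ (ℕP.∸-monoˡ-≤ (suc r) colLen-mono) (ℕP.∸-monoʳ-≤ (nth κ r) c≤d)
  where
  colLen-mono : colLen κ d ≤ colLen κ c
  colLen-mono with colLen κ d in eq
  ... | zero  = z≤n
  ... | suc m = colLen-⁺ κ c dec m (ℕP.≤-<-trans c≤d (colLen-⁻ κ d dec m (≡.subst (m <_) (≡.sym eq) ℕP.≤-refl)))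

-- The k-skew diagram of a core

module Core (k : ℕ) (1≤k : 1 ≤ k) (lam : List ℕ) (lam∈Par : InPar k lam)
  (κ : List ℕ) (κ-partition : IsPartition κ) (κ-core : IsCore k κ)
  (p≡lam : ∀ r → pPart k κ r ≡ nth lam r) where

  n : ℕ
  n = length κ

  K L η : ℕ → ℕ
  K = nth κ
  L = nth lam
  η = etaN κ lam

  K-dec : Decreasing κ
  K-dec = proj₂ κ-partition

  K-antitone : ∀ {r s} → r ≤ s → K s ≤ K r
  K-antitone = nth-antitone κ K-dec

  L-antitone : ∀ {r s} → r ≤ s → L s ≤ L r
  L-antitone = nth-antitone lam (proj₂ (proj₁ lam∈Par))

  L≤k : ∀ r → L r ≤ k
  L≤k = nth-≤ (proj₂ lam∈Par)

  K>0 : ∀ {r} → r < n → 0 < K r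
  K>0 = nth-positive (proj₁ κ-partition)

  -- Hook lengths decrease along a row, so the boxes of hook length at most k form its end. There
  -- are L r of them, so they start in column η r.
  short-hooks : ∀ r → L r ≤ K r × (∀ c → c < K r → hook κ r c ≤ k → η r ≤ c)
                               × (∀ c → c < K r → η r ≤ c → hook κ r c ≤ k)
  short-hooks r with threshold (λ c → hook κ r c ℕ.≤? k) (K r)
    (λ c≤d _ → ℕP.≤-trans (hook-antitone κ K-dec r c≤d))
  ... | m , m≤K , to , from =
    ≡.subst (_≤ K r) (≡.sym L≡) (ℕP.m∸n≤m (K r) m)
    , (λ c c<K p → ≡.subst (_≤ c) (≡.sym η≡m) (to c c<K p))
    , (λ c c<K p → from c c<K (≡.subst (_≤ c) η≡m p))
    where
    L≡ : L r ≡ K r ∸ m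
    L≡ = ≡.trans (≡.sym (p≡lam r)) (≡.trans
      (count-interval (λ c → hook κ r c ℕ.≤? k) m (K r) (K r)
        (λ c c<K p → to c c<K p , c<K) (λ c c<K m≤c _ → from c c<K m≤c))
      (≡.cong (_∸ m) (ℕP.⊓-idem (K r))))
    η≡m : η r ≡ m
    η≡m = ≡.trans (≡.cong (K r ∸_) L≡) (ℕP.m∸[m∸n]≡n m≤K)

  L≤K : ∀ r → L r ≤ K r
  L≤K r = proj₁ (short-hooks r)

  η≤K : ∀ r → η r ≤ K r
  η≤K r = ℕP.m∸n≤m (K r) (L r)

  K∸η : ∀ r → K r ∸ η r ≡ L r
  K∸η r = ℕP.m∸[m∸n]≡n (L≤K r)

  -- The inequality k - λ_i + i < j for 0-based indices; the strict sign gives the `suc`, and L r ≤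
  -- k makes the subtraction exact.
  D : ℕ → ℕ
  D r = r + suc (k ∸ L r)

  -- A core has no hook of length k + 1: the hook length in row r jumps over k + 1 between
  -- columns η r - 1 and η r, which pins down the row in which the column lengths change.
  K-D : ∀ r → K (D r) ≡ η r
  K-D r = ℕP.≤-antisym (ℕP.≮⇒≥ upper) lower
    where
    r≤D : r ≤ D r
    r≤D = ℕP.m≤m+n r _
    k<[1+k∸L]+L : k < suc (k ∸ L r) + L r
    k<[1+k∸L]+L = s≤s (ℕP.≤-reflexive (≡.sym (ℕP.m∸n+n≡m (L≤k r))))
    upper : ¬ (η r < K (D r))
    upper η<K = ℕP.<⇒≱ k<[1+k∸L]+L (ℕP.≤-trans (ℕP.+-mono-≤ leg (ℕP.≤-reflexive (≡.sym (K∸η r))))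
      (proj₂ (proj₂ (short-hooks r)) (η r) (ℕP.<-≤-trans η<K (K-antitone r≤D)) ℕP.≤-refl))
      where
      leg : suc (k ∸ L r) ≤ colLen κ (η r) ∸ suc r
      leg = ≡.subst (_≤ colLen κ (η r) ∸ suc r) (ℕP.m+n∸m≡n r _)
        (ℕP.∸-monoˡ-≤ (suc r) (colLen-⁺ κ (η r) K-dec (D r) η<K))
    lower : η r ≤ K (D r)
    lower with η r in eq
    ... | zero  = z≤n
    ... | suc c = colLen-⁻ κ c K-dec (D r) (ℕP.≤-trans
            (ℕP.≤-reflexive (≡.sym (ℕP.+-suc r _)))
            (ℕP.≤-trans (ℕP.+-monoʳ-≤ r (s≤s leg)) (ℕP.≤-reflexive r+1+leg)))
      where
      c<K : c < K r
      c<K = ≡.subst (_≤ K r) eq (η≤K r)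
      K∸c : K r ∸ c ≡ suc (L r)
      K∸c = ≡.trans (ℕP.+-∸-assoc 1 c<K) (≡.cong suc (≡.trans (≡.cong (K r ∸_) (≡.sym eq)) (K∸η r)))
      -- Column c = η r - 1 lies just before the short hooks, so its hook length exceeds k, and by
      -- the core condition also k + 1.
      long : suc (suc k) ≤ hook κ r c
      long = ℕP.≤∧≢⇒< (ℕP.≰⇒> (λ p → ℕP.1+n≰n (≡.subst (_≤ c) eq (proj₁ (proj₂ (short-hooks r)) c c<K p))))
        (λ e → κ-core r c (nth-<length κ (ℕP.≤-<-trans z≤n c<K)) c<K (≡.sym e))
      leg : suc (k ∸ L r) ≤ colLen κ c ∸ suc r
      leg = ℕP.+-cancelʳ-≤ (suc (L r)) _ _ (ℕP.≤-trans
        (ℕP.≤-reflexive (≡.cong suc (≡.trans (ℕP.+-suc _ _) (≡.cong suc (ℕP.m∸n+n≡m (L≤k r))))))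
        (ℕP.≤-trans long (ℕP.≤-reflexive (≡.cong (ℕ._+_ (colLen κ c ∸ suc r)) K∸c))))
      r<len : suc r ≤ colLen κ c
      r<len = colLen-⁺ κ c K-dec r c<K
      r+1+leg : r + suc (colLen κ c ∸ suc r) ≡ colLen κ c
      r+1+leg = ≡.trans (ℕP.+-suc r _) (ℕP.m+[n∸m]≡n r<len)

  r<D : ∀ r → r < D r
  r<D r = ℕP.m<m+n r (s≤s z≤n)

  D-shift : ∀ r t → D r + t ≤ D (r + t)
  D-shift r t = ℕP.≤-trans (ℕP.≤-reflexive (≡.trans (ℕP.+-assoc r _ t)
      (≡.trans (≡.cong (ℕ._+_ r) (ℕP.+-comm _ t)) (≡.sym (ℕP.+-assoc r t _)))))
    (ℕP.+-monoʳ-≤ (r + t) (s≤s (ℕP.∸-monoʳ-≤ k (L-antitone (ℕP.m≤m+n r t)))))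

  D-mono : ∀ {r s} → r < s → D r < D s
  D-mono {r} r<s with ℕP.m≤n⇒∃[o]m+o≡n r<s
  ... | o , ≡.refl = ≡.subst (λ s → D r < D s) (ℕP.+-suc r o)
    (ℕP.<-≤-trans (ℕP.m<m+n (D r) (s≤s z≤n)) (D-shift r (suc o)))

  -- A difference of decreasing sequences need not decrease; but by `K-D` it is the decreasing κ
  -- composed with the increasing `D`.
  η-antitone : ∀ {r s} → r ≤ s → η s ≤ η r
  η-antitone {r} {s} r≤s with ℕP.m≤n⇒m<n∨m≡n r≤s
  ... | inj₂ ≡.refl = ℕP.≤-refl
  ... | inj₁ r<s = ≡.subst₂ _≤_ (K-D s) (K-D r) (K-antitone (ℕP.<⇒≤ (D-mono r<s)))

  D<n⇒η>0 : ∀ {r} → D r < n → 0 < η r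
  D<n⇒η>0 {r} p = ≡.subst (0 <_) (K-D r) (K>0 p)

  first-below : ∀ c → ∃ λ m → m ≤ n × (∀ r → r < n → η r < c → m ≤ r) × (∀ r → r < n → m ≤ r → η r < c)
  first-below c = threshold (λ r → η r ℕ.<? c) n (λ r≤s _ → ℕP.≤-<-trans (η-antitone r≤s))

  lenEta-⁺ : ∀ {r} → 0 < η r → suc r ≤ lenEta κ lam
  lenEta-⁻ : ∀ {r} → suc r ≤ lenEta κ lam → 0 < η r

  private
    lenEta≡ : lenEta κ lam ≡ proj₁ (first-below 1)
    lenEta≡ with first-below 1
    ... | m , m≤n , to , from = ≡.trans
      (count-interval (λ r → 0 ℕ.<? etaN κ lam r) 0 m n
        (λ r r<n p → z≤n , ℕP.≰⇒> (λ m≤r → ℕP.<⇒≱ (from r r<n m≤r) p))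
        (λ r r<n _ r<m → ℕP.≮⇒≥ (λ q → ℕP.<⇒≱ r<m (to r r<n q))))
      (ℕP.m≤n⇒m⊓n≡m m≤n)

  lenEta-⁺ {r} p rewrite lenEta≡ with first-below 1
  ... | m , m≤n , to , from = ℕP.≰⇒> (λ m≤r → ℕP.<⇒≱ (from r (nth-<length κ (ℕP.<-≤-trans p (η≤K r))) m≤r) p)

  lenEta-⁻ {r} p rewrite lenEta≡ with first-below 1
  ... | m , m≤n , to , from = ℕP.≮⇒≥ (λ q → ℕP.<⇒≱ p (to r (ℕP.<-≤-trans p m≤n) q))

  -- Column c of κ/η (column c + 1 in the numbering of mu) occupies the rows m, …, M - 1.
  record Band (c : ℕ) : Set where
    field
      m M      : ℕ
      M≤n      : M ≤ n
      η-above  : ∀ s → s < m → c < η s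
      η-below  : ∀ s → m ≤ s → η s ≤ c
      K-above  : ∀ s → s < M → c < K s
      K-below  : ∀ s → c < K s → s < M
      mu≡      : mu κ lam (suc c) ≡ M ∸ m

  band : ∀ c → Band c
  band c with first-below (suc c)
  ... | m , m≤n , to , from = record
    { m = m ; M = M ; M≤n = colLen-≤ κ c
    ; η-above = λ s s<m → ℕP.≮⇒≥ (λ q → ℕP.<⇒≱ s<m (to s (ℕP.<-≤-trans s<m m≤n) q))
    ; η-below = below
    ; K-above = colLen-⁻ κ c K-dec
    ; K-below = colLen-⁺ κ c K-dec
    ; mu≡ = ≡.trans (count-interval _ m M n
        (λ s s<n (p , q) → to s s<n p , colLen-⁺ κ c K-dec s q)
        (λ s s<n m≤s s<M → from s s<n m≤s , colLen-⁻ κ c K-dec s s<M))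
        (≡.cong (_∸ m) (ℕP.m≤n⇒m⊓n≡m (colLen-≤ κ c))) }
    where
    M = colLen κ c
    below : ∀ s → m ≤ s → η s ≤ c
    below s m≤s with s ℕ.<? n
    ... | yes s<n = ℕP.≤-pred (from s s<n m≤s)
    ... | no s≮n  = ℕP.≤-trans (ℕP.≮⇒≥ (λ p → s≮n (nth-<length κ (ℕP.≤-<-trans z≤n (ℕP.<-≤-trans p (η≤K s)))))) z≤n

  -- The first columns of row r in Δ^k(λ) and in Φ(κ/η); n if there is none.
  D' : ℕ → ℕ
  D' r = D r ⊓ n

  P : ℕ → ℕ
  P r with η r
  ... | zero  = n
  ... | suc c = r + mu κ lam (suc c)

  P-0 : ∀ {r} → η r ≡ 0 → P r ≡ n
  P-0 e rewrite e = ≡.refl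

  P-suc : ∀ {r c} → η r ≡ suc c → P r ≡ r + mu κ lam (suc c)
  P-suc e rewrite e = ≡.refl

  module Row {r c : ℕ} (ηr : η r ≡ suc c) where
    open Band (band c) public

    r<m : r < m
    r<m = ℕP.≰⇒> (λ m≤r → ℕP.1+n≰n (≡.subst (_≤ c) ηr (η-below r m≤r)))

    -- r + t is the last row in which column c belongs to η.
    P-bounds : D r ≤ P r × P r < M
    P-bounds with ℕP.m≤n⇒∃[o]m+o≡n r<m
    ... | t , 1+r+t≡m = D≤P , P<M
      where
      open ℕP.≤-Reasoning
      -- Row D (r + t) of κ has length η (r + t) > c, so it meets column c.
      D+t<M : D r + t < M
      D+t<M = ℕP.≤-<-trans (D-shift r t) (K-below (D (r + t))
        (≡.subst (c <_) (≡.sym (K-D (r + t))) (η-above (r + t) (ℕP.≤-reflexive 1+r+t≡m))))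
      P≡ : P r ≡ r + (M ∸ m)
      P≡ = ≡.trans (P-suc ηr) (≡.cong (ℕ._+_ r) mu≡)
      m≤M : m ≤ M
      m≤M = begin
        m               ≡⟨ 1+r+t≡m ⟨
        suc (r + t)     ≤⟨ s≤s (ℕP.+-monoˡ-≤ t (ℕP.<⇒≤ (r<D r))) ⟩
        suc (D r + t)   ≤⟨ D+t<M ⟩
        M               ∎
      P+1+t : P r + suc t ≡ M
      P+1+t = begin-equality
        P r + suc t           ≡⟨ ≡.cong (_+ suc t) (≡.trans P≡ (ℕP.+-comm r _)) ⟩
        M ∸ m + r + suc t     ≡⟨ ℕP.+-assoc (M ∸ m) r _ ⟩
        M ∸ m + (r + suc t)   ≡⟨ ≡.cong (ℕ._+_ (M ∸ m)) (≡.trans (ℕP.+-suc r t) 1+r+t≡m) ⟩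
        M ∸ m + m             ≡⟨ ℕP.m∸n+n≡m m≤M ⟩
        M                     ∎
      D≤P : D r ≤ P r
      D≤P = ℕP.+-cancelʳ-≤ (suc t) _ _ (begin
        D r + suc t   ≡⟨ ℕP.+-suc (D r) t ⟩
        suc (D r + t) ≤⟨ D+t<M ⟩
        M             ≡⟨ P+1+t ⟨
        P r + suc t   ∎)
      P<M : P r < M
      P<M = begin-strict
        P r         <⟨ ℕP.m<m+n (P r) (s≤s z≤n) ⟩
        P r + suc t ≡⟨ P+1+t ⟩
        M           ∎

    D≤P' : D r ≤ P r
    D≤P' = proj₁ P-bounds

    P<M : P r < M
    P<M = proj₂ P-bounds

    P<n' : P r < n
    P<n' = ℕP.<-≤-trans P<M M≤n

    -- Row D r, of length η r, bounds these rows from above, and the boxes of column c bound them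
    -- from below.
    K-plateau : ∀ {j} → D r ≤ j → j < M → K j ≡ suc c
    K-plateau {j} D≤j j<M = ℕP.≤-antisym
      (ℕP.≤-trans (K-antitone D≤j) (ℕP.≤-reflexive (≡.trans (K-D r) ηr))) (K-above j j<M)

  D'≤P : ∀ r → D' r ≤ P r
  D'≤P r with η r in eq
  ... | zero  = ℕP.m⊓n≤n (D r) n
  ... | suc c = ℕP.≤-trans (ℕP.m⊓n≤m (D r) n) (≡.subst (D r ≤_) (P-suc eq) (Row.D≤P' eq))

  η-zero? : ∀ r → η r ≡ 0 ⊎ ∃ λ c → η r ≡ suc c
  η-zero? r with η r
  ... | zero  = inj₁ ≡.refl
  ... | suc c = inj₂ (c , ≡.refl)

  η≡0⇒n≤D : ∀ {r} → η r ≡ 0 → n ≤ D r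
  η≡0⇒n≤D e = ℕP.≮⇒≥ (λ p → ℕP.<⇒≢ (D<n⇒η>0 p) (≡.sym e))

  D'<n⇒η>0 : ∀ {r} → D' r < n → ∃ λ c → η r ≡ suc c
  D'<n⇒η>0 {r} p with η-zero? r
  ... | inj₁ e = contradiction (ℕP.m≥n⇒m⊓n≡n (η≡0⇒n≤D e)) (ℕP.<⇒≢ p)
  ... | inj₂ x = x

  -- Rows with equal η have the same μ and move in parallel. If η drops, the plateau of r ends
  -- before row D s, whose length is too small to meet column c.
  P-mono : ∀ {r s} → r < s → P r < n → P r < P s
  P-mono {r} {s} r<s Pr<n with η-zero? r | η-zero? s
  ... | inj₁ e | _ = contradiction (P-0 {r} e) (ℕP.<⇒≢ Pr<n)
  ... | inj₂ _ | inj₁ e = ≡.subst (P r <_) (≡.sym (P-0 {s} e)) Pr<n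
  ... | inj₂ (c , ηr) | inj₂ (c' , ηs) with c ℕ.≟ c'
  ...   | yes ≡.refl = ≡.subst₂ _<_ (≡.sym (P-suc {r} ηr)) (≡.sym (P-suc {s} ηs)) (ℕP.+-monoˡ-< _ r<s)
  ...   | no c≢c' = ℕP.<-≤-trans (Row.P<M {r} ηr) (ℕP.≤-trans M≤D (Row.D≤P' {s} ηs))
    where
    open Row {r} ηr using (M; K-above)
    c'<c : c' < c
    c'<c = ℕP.≤∧≢⇒< (ℕP.≤-pred (≡.subst₂ _≤_ ηs ηr (η-antitone (ℕP.<⇒≤ r<s)))) (λ e → c≢c' (≡.sym e))
    M≤D : M ≤ D s
    M≤D = ℕP.≮⇒≥ (λ D<M → ℕP.<⇒≱ (K-above (D s) D<M)
      (≡.subst (_≤ c) (≡.sym (≡.trans (K-D s) ηs)) c'<c))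

  E : ℕ → Set
  E j = suc j < n × K j ≡ K (suc j)

  -- λ is κ minus the decreasing η, so it cannot drop where κ is constant; being a partition, it
  -- cannot rise.
  E⇒L≡ : ∀ {j} → E j → L j ≡ L (suc j)
  E⇒L≡ {j} (_ , e) = ℕP.≤-antisym
    (≡.subst₂ _≤_ (K∸η j) (≡.trans (≡.cong (_∸ η (suc j)) e) (K∸η (suc j)))
      (ℕP.∸-monoʳ-≤ (K j) (η-antitone (ℕP.n≤1+n j))))
    (L-antitone (ℕP.n≤1+n j))

  E⇒η≡ : ∀ {j} → E j → η j ≡ η (suc j)
  E⇒η≡ Ej@(_ , e) = ≡.cong₂ _∸_ e (E⇒L≡ Ej)

  -- If D j were j + 1, then κ_j = κ_{j+1} = η_j and λ_j = 0; but then D j = j + k + 1, and k is at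
  -- least 1.
  E⇒late : ∀ {j} → E j → suc j < D' j
  E⇒late {j} Ej@(1+j<n , e) = ℕP.⊓-glb (ℕP.≤∧≢⇒< (r<D j) D≢1+j) 1+j<n
    where
    D≢1+j : suc j ≢ D j
    D≢1+j 1+j≡D = ℕP.<⇒≢ (ℕP.+-monoʳ-< j (s≤s 0<k∸L)) (≡.trans (ℕP.+-comm j 1) 1+j≡D)
      where
      K≡η : K j ≡ η j
      K≡η = ≡.trans e (≡.trans (≡.cong K 1+j≡D) (K-D j))
      L≡0 : L j ≡ 0
      L≡0 = ≡.trans (≡.sym (K∸η j)) (≡.trans (≡.cong (_∸ η j) K≡η) (ℕP.n∸n≡0 (η j)))
      0<k∸L : 0 < k ∸ L j
      0<k∸L rewrite L≡0 = 1≤k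

  D'-mono : ∀ {r s} → r < s → D' r < n → D' r < D' s
  D'-mono {r} r<s p = ℕP.⊓-glb (ℕP.≤-<-trans (ℕP.m⊓n≤m (D r) n) (D-mono r<s)) p

  E-gap : ∀ {r j} → D' r ≤ j → j < P r → E j
  E-gap {r} {j} D'≤j j<P with η-zero? r
  ... | inj₁ e = contradiction (≡.subst (_≤ j) (ℕP.m≥n⇒m⊓n≡n (η≡0⇒n≤D {r} e)) D'≤j)
                   (ℕP.<⇒≱ (≡.subst (j <_) (P-0 {r} e) j<P))
  ... | inj₂ (c , ηr) = ℕP.<-≤-trans 1+j<M M≤n
      , ≡.trans (K-plateau D≤j (ℕP.<-trans ℕP.≤-refl 1+j<M)) (≡.sym (K-plateau (ℕP.m≤n⇒m≤1+n D≤j) 1+j<M))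
    where
    open Row {r} ηr
    1+j<M : suc j < M
    1+j<M = ℕP.≤-<-trans j<P P<M
    D≤j : D r ≤ j
    D≤j = ≡.subst (_≤ j) (ℕP.m≤n⇒m⊓n≡m (ℕP.≤-trans D≤P' (ℕP.<⇒≤ P<n'))) D'≤j

  -- Equal rows of κ have equal η. If it is 0, both rows of Φ are empty. Otherwise they share μ and
  -- column c, and P j and P j + 1 both lie on the plateau that ends at M.
  E-next : ∀ {j} → E j → P j ≡ P (suc j) ⊎ (P (suc j) ≡ suc (P j) × E (P j))
  E-next {j} Ej with η-zero? j
  ... | inj₁ e = inj₁ (≡.trans (P-0 {j} e) (≡.sym (P-0 {suc j} (≡.trans (≡.sym (E⇒η≡ Ej)) e))))
  ... | inj₂ (c , ηj) = inj₂ (Psuc , ℕP.<-≤-trans 1+P<M M≤n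
      , ≡.trans (K-plateau D≤P' P<M) (≡.sym (K-plateau (ℕP.m≤n⇒m≤1+n D≤P') 1+P<M)))
    where
    open Row {j} ηj
    η1+j : η (suc j) ≡ suc c
    η1+j = ≡.trans (≡.sym (E⇒η≡ Ej)) ηj
    Psuc : P (suc j) ≡ suc (P j)
    Psuc = ≡.trans (P-suc {suc j} η1+j) (≡.cong suc (≡.sym (P-suc {j} ηj)))
    1+P<M : suc (P j) < M
    1+P<M = ≡.subst (_< M) Psuc (Row.P<M {suc j} η1+j)

  interpolation : Interpolation n (lamVec κ lam) D' P
  interpolation = record
    { E      = E
    ; D-mono = D'-mono
    ; P-mono = P-mono
    ; D≤P    = D'≤P
    ; P<n    = λ r p → Row.P<n' {r} (proj₂ (D'<n⇒η>0 p))
    ; r<D    = λ r r<n → ℕP.⊓-glb (r<D r) r<n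
    ; E-gap  = λ {r} → E-gap {r}
    ; E<n    = proj₁
    ; E-flat = λ Ej a b a≡ b≡ → ≡.cong +_ (≡.trans (≡.cong L a≡) (≡.trans (E⇒L≡ Ej) (≡.cong L (≡.sym b≡))))
    ; E-late = λ {j} Ej → ℕP.<-≤-trans (E⇒late Ej) (D'≤P j)
    ; E-next = E-next }

  DeltaK≡roots : DeltaK k κ lam ≡ roots D'
  DeltaK≡roots = filter-≐ _ _ ((λ {β} → to β) , (λ {β} → from β)) (allPairs n)
    where
    lhs : ∀ (i : Fin n) → + k ℤ.- lamVec κ lam i ℤ.+ + suc (toℕ i) ≡ + D (toℕ i)
    lhs i = ≡.trans (≡.cong (ℤ._+ + suc r) (≡.trans (ℤP.m-n≡m⊖n k (L r)) (ℤP.⊖-≥ (L≤k r))))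
      (≡.cong +_ (≡.trans (ℕP.+-comm (k ∸ L r) (suc r)) (≡.sym (ℕP.+-suc r _))))
      where r = toℕ i
    to : ∀ ((i , j) : Fin n × Fin n) →
      toℕ i < toℕ j × (+ k ℤ.- lamVec κ lam i ℤ.+ + suc (toℕ i)) ℤ.< + suc (toℕ j) → D' (toℕ i) ≤ toℕ j
    to (i , j) (_ , q) = ℕP.≤-trans (ℕP.m⊓n≤m _ n)
      (ℕP.≤-pred (ℤP.drop‿+<+ (≡.subst (ℤ._< + suc (toℕ j)) (lhs i) q)))
    from : ∀ ((i , j) : Fin n × Fin n) → D' (toℕ i) ≤ toℕ j →
      toℕ i < toℕ j × (+ k ℤ.- lamVec κ lam i ℤ.+ + suc (toℕ i)) ℤ.< + suc (toℕ j)
    from (i , j) p = ℕP.<-≤-trans (r<D (toℕ i)) D≤j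
                   , ≡.subst (ℤ._< + suc (toℕ j)) (≡.sym (lhs i)) (ℤ.+<+ (s≤s D≤j))
      where
      D≤j : D (toℕ i) ≤ toℕ j
      D≤j with ℕP.⊓-sel (D (toℕ i)) n
      ... | inj₁ e = ≡.subst (_≤ toℕ j) e p
      ... | inj₂ e = contradiction (≡.subst (_≤ toℕ j) e p) (ℕP.<⇒≱ (FinP.toℕ<n j))

  PhiK≡roots : PhiK κ lam ≡ roots P
  PhiK≡roots = filter-≐ _ _ ((λ {β} → to β) , (λ {β} → from β)) (allPairs n)
    where
    to : ∀ ((i , j) : Fin n × Fin n) →
      toℕ i < toℕ j × (suc (toℕ i) ≤ lenEta κ lam) × (mu κ lam (η (toℕ i)) + suc (toℕ i) ≤ suc (toℕ j)) →
      P (toℕ i) ≤ toℕ j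
    to (i , j) (_ , q , q') with η-zero? (toℕ i)
    ... | inj₁ e = contradiction (≡.sym e) (ℕP.<⇒≢ (lenEta-⁻ q))
    ... | inj₂ (c , e) = ≡.subst (_≤ toℕ j)
          (≡.trans (≡.cong (λ x → mu κ lam x + toℕ i) e) (≡.trans (ℕP.+-comm _ (toℕ i)) (≡.sym (P-suc {toℕ i} e))))
          (ℕP.≤-pred (≡.subst (_≤ suc (toℕ j)) (ℕP.+-suc _ (toℕ i)) q'))
    from : ∀ ((i , j) : Fin n × Fin n) → P (toℕ i) ≤ toℕ j →
      toℕ i < toℕ j × (suc (toℕ i) ≤ lenEta κ lam) × (mu κ lam (η (toℕ i)) + suc (toℕ i) ≤ suc (toℕ j))
    from (i , j) p with η-zero? (toℕ i)
    ... | inj₁ e = contradiction (≡.subst (_≤ toℕ j) (P-0 {toℕ i} e) p) (ℕP.<⇒≱ (FinP.toℕ<n j))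
    ... | inj₂ (c , e) = ℕP.<-≤-trans (r<D (toℕ i)) (ℕP.≤-trans (Row.D≤P' {toℕ i} e) p)
          , lenEta-⁺ (≡.subst (0 <_) (≡.sym e) (s≤s z≤n))
          , ℕP.≤-trans (ℕP.≤-reflexive (≡.trans (ℕP.+-suc _ (toℕ i)) (≡.cong suc
              (≡.trans (≡.cong (λ x → mu κ lam x + toℕ i) e) (≡.trans (ℕP.+-comm _ (toℕ i)) (≡.sym (P-suc {toℕ i} e)))))))
              (s≤s p)

theorem10p4 : {c ℓ : Level} (R : CommutativeRing c ℓ) (h : ℕ → CommutativeRing.Carrier R)
    (k : ℕ) → 1 ≤ k → (lam : List ℕ) → InPar k lam →
    (κ : List ℕ) → IsPartition κ → IsCore k κ → (∀ r → pPart k κ r ≡ nth lam r) →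
    (d : ℕ) →
    CommutativeRing._≈_ R
    (SymFun.coeffH R h (DeltaK k κ lam) d (lamVec κ lam))
    (SymFun.coeffH R h (PhiK κ lam) d (lamVec κ lam))
theorem10p4 R h k 1≤k lam lam∈Par κ κ-partition κ-core p≡lam d =
  ≡.subst₂ (λ Ψ Φ → CommutativeRing._≈_ R (SymFun.coeffH R h Ψ d (lamVec κ lam)) (SymFun.coeffH R h Φ d (lamVec κ lam)))
    (≡.sym DeltaK≡roots) (≡.sym PhiK≡roots) (coeffH-interpolate R h interpolation d)
  where open Core k 1≤k lam lam∈Par κ κ-partition κ-core p≡lam
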